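{- Let $n\ge 2$ and let $\mathscr{M}_n\subset\mathbb{Z}_{\ge0}^{n^2-n}$ be the monoid of ordered score sheets of a round-robin tournament between $n$ teams, graded by $\deg S=\sum_{i\neq j}g_{ij}$. Then the multiplicity of $\mathscr{M}_n$ is \[ e(\mathscr{M}_n)=\frac{1}{n!}. \] Consequently, all polynomial components of the quasipolynomial representing the Hilbert function $G\mapsto \#\{S\in\mathscr{M}_n:\deg S=G\}$ have the same leading coefficient $\frac{1}{n!\,(n^2-n-1)!}$, and \[ \lim_{G\to\infty}\frac{\#\{S\in\mathscr{M}_n:\deg S=G\}}{G^{n^2-n-1}}=\frac{1}{n!\,(n^2-n-1)!}. \]
   Context: A score sheet of a round-robin tournament between $n$ teams is a family $S=(g_{ij})_{1\le i\neq j\le n}$ of nonnegative integers, identified with an element of $\mathbb{Z}_{\ge 0}^{n^2-n}$. Let $g_i=\sum_{j\neq i}g_{ij}$. The ordered score sheets are those with $g_1\ge\cdots\ge g_n$; they form an affine monoid $\mathscr{M}_n=C\cap\mathbb{Z}^{n^2-n}$ where $C=\mathbb{R}_+\mathscr{M}_n$ is a full-dimensional rational cone. For a full-dimensional cone $C\subset\mathbb{R}^d$ with $M=C\cap\mathbb{Z}^d$ and a linear grading $\deg$ positive on $M\setminus\{0\}$ taking the value $1$ somewhere on $\mathbb{Z}^d$, the multiplicity $e(M)$ is the lattice-normalized volume of the polytope $C\cap\{\deg=1\}$ (normalized so that a lattice simplex of smallest possible volume in the hyperplane $\deg=1$ has volume $1$); equivalently the Hilbert function $H(M,G)=\#\{x\in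 M:\deg x=G\}$ agrees for $G\ge0$ with a quasipolynomial of degree $d-1$ whose components all have leading coefficient $e(M)/(d-1)!$. -}

module Defs where

open import Data.Nat as ℕ using (ℕ; zero; suc; _∸_; _≤ᵇ_)
open import Data.Nat.DivMod using (_mod_)
open import Data.Bool using (Bool; true; false; _∧_)
open import Data.List as List using (List; []; _∷_; [_]; concatMap; upTo; filterᵇ; length)
open import Data.Vec as Vec using (Vec; []; _∷_)
open import Data.Fin using (Fin)
open import Data.Integer using (+_)
open import Data.Rational using (ℚ; _/_; 0ℚ; 1ℚ; _+_; _*_; _-_; ∣_∣; _<_)
open import Data.Product using (Σ; _×_; ∃)
open import Relation.Binary.PropositionalEquality using (_≡_)

-- A score sheet of n teams is stored as n rows; row i lists the n-1
-- entries g_{ij}, j ≠ i (in increasing order of j).  This is a fixed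
-- bijection with ℤ_{≥0}^{n²-n}.
ScoreSheet : ℕ → Set
ScoreSheet n = Vec (Vec ℕ (n ∸ 1)) n

vecsSum : (k : ℕ) → ℕ → List (Vec ℕ k)
vecsSum zero zero = [ [] ]
vecsSum zero (suc _) = []
vecsSum (suc k) G = concatMap (λ a → List.map (a ∷_) (vecsSum k (G ∸ a))) (upTo (suc G))

matsSum : (r k : ℕ) → ℕ → List (Vec (Vec ℕ k) r)
matsSum zero k zero = [ [] ]
matsSum zero k (suc _) = []
matsSum (suc r) k G =
  concatMap (λ a → concatMap (λ row → List.map (row ∷_) (matsSum r k (G ∸ a))) (vecsSum k a))
            (upTo (suc G))

teamScores : ∀ {n} → ScoreSheet n → Vec ℕ n
teamScores = Vec.map Vec.sum

decreasingᵇ : ∀ {m} → Vec ℕ m → Bool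
decreasingᵇ [] = true
decreasingᵇ (x ∷ []) = true
decreasingᵇ (x ∷ y ∷ xs) = (y ≤ᵇ x) ∧ decreasingᵇ (y ∷ xs)

isOrderedᵇ : ∀ {n} → ScoreSheet n → Bool
isOrderedᵇ S = decreasingᵇ (teamScores S)

hilbert : ℕ → ℕ → ℕ
hilbert n G = length (filterᵇ isOrderedᵇ (matsSum n (n ∸ 1) G))

ℕtoℚ : ℕ → ℚ
ℕtoℚ m = (+ m) / 1

evalPoly : ∀ {k} → Vec ℚ k → ℚ → ℚ
evalPoly [] x = 0ℚ
evalPoly (c ∷ cs) x = c + x * evalPoly cs x

_^ℚ_ : ℚ → ℕ → ℚ
x ^ℚ zero = 1ℚ
x ^ℚ suc m = x * (x ^ℚ m)

-- H agrees for all G ≥ 0 with a quasipolynomial of period (suc q), whose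
-- components are polynomials of degree D (coefficient vectors of length
-- suc D, last entry = coefficient of G^D), all having leading coefficient lc.
HasQuasiPolyLC : (ℕ → ℕ) → (D : ℕ) → ℚ → Set
HasQuasiPolyLC H D lc =
  Σ ℕ λ q → Σ (Fin (suc q) → Vec ℚ (suc D)) λ P →
    ((r : Fin (suc q)) → Vec.last (P r) ≡ lc) ×
    ((G : ℕ) → ℕtoℚ (H G) ≡ evalPoly (P (G mod suc q)) (ℕtoℚ G))

-- lim_{G→∞} H(G)/G^D = L, stated as: ∀ ε>0 ∃ N ∀ G ≥ N (G ≥ 1),
-- |H(G)/G^D − L| < ε, written with G^D multiplied out (G^D > 0).
HasLimitOverPower : (ℕ → ℕ) → (D : ℕ) → ℚ → Set
HasLimitOverPower H D L =
  (ε : ℚ) → 0ℚ < ε → ∃ λ N → (G : ℕ) → N ℕ.≤ G → 1 ℕ.≤ G →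
    ∣ ℕtoℚ (H G) - L * (ℕtoℚ G ^ℚ D) ∣ < ε * (ℕtoℚ G ^ℚ D)

{-# OPTIONS --safe #-}
module Submission where

-- Put k = n − 1. A row of k entries with sum a can be chosen in B k a ways, where B k lists the
-- coefficients of 1 / (1 − x)ᵏ, so the generating function of the ordered sheets with m rows of
-- length k is the complete homogeneous symmetric function hₘ in the variables y_a = B k a xᵃ.
-- Newton's identity m hₘ = Σ_{1 ≤ i ≤ m} pᵢ hₘ₋ᵢ then computes hₘ recursively.  The power sum p₁ is
-- 1 / (1 − x)ᵏ, while for i ≥ 2 the coefficients of pᵢ grow so slowly that pᵢ hₘ₋ᵢ only affects
-- terms of lower degree; hence hₘ = (1 / m!) (1 − x)^(− m k) up to a quasipolynomial of degree
-- at most m k − 2.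

open import Defs
open import Algebra.Bundles using (CommutativeRing; Semiring)
open import Data.Bool.Base using (Bool; true; false; if_then_else_; _∧_)
open import Data.Fin.Base as Fin using (Fin; toℕ)
open import Data.Integer.Base as ℤ using (-[1+_])
import Data.Integer.Properties as ℤₚ
open import Data.List.Base as List using (List; []; _∷_; _++_; applyUpTo; concatMap; filterᵇ; length)
import Data.List.Properties as Listₚ
open import Data.List.Relation.Unary.All as All using (All; []; _∷_)
import Data.List.Relation.Unary.All.Properties as Allₚ
import Data.Nat
open import Data.Nat as ℕ
  using (ℕ; zero; suc; _≤_; z≤n; s≤s; NonZero; _∸_; _!; _≤ᵇ_; _<ᵇ_)
import Data.Nat.DivMod as ℕ
import Data.Nat.Divisibility as ℕ
import Data.Nat.Properties as ℕₚ
open import Data.Product using (_,_)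
import Data.Rational
import Data.Rational.Properties as ℚₚ
open import Data.Rational.Solver using (module +-*-Solver)
open import Data.Rational.Unnormalised.Base as ℚᵘ using (mkℚᵘ)
import Data.Rational.Unnormalised.Properties as ℚᵘₚ
open import Data.Sum.Base using (inj₁; inj₂)
open import Data.Vec as Vec using (Vec; []; _∷_)
open import Function.Base using (_∘_; id)
import Relation.Binary.Reasoning.Setoid as SetoidReasoning

-- Formal power series

-- A weakly decreasing sequence of m row sums is a multiset, hence a monomial of degree m in the
-- y_a. Counting multisets as sequences divided by m! is wrong only where sums repeat; Newton's
-- identity accounts for the repetitions without any case distinction. The growth of pᵢ = Σ (B k a)ⁱ
-- x^(i a) is governed by (B k a)ⁱ, a polynomial in a of degree i (k - 1). So pᵢ has pole order at
-- most i (k - 1) + 1, and this is at most i k - 1 exactly when i ≥ 2. As pᵢ is a series in xⁱ, the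
-- period has to be a multiple of 1, ..., n, which n! is. The quasipolynomials have to be exact from
-- G = 0 on, and h₀ = 1 is not one of these. This is why index 0 is treated separately throughout.

module Series {c ℓ} (R : CommutativeRing c ℓ) where
  open CommutativeRing R
  open SetoidReasoning setoid
  open import Algebra.Solver.Ring.NaturalCoefficients.Default commutativeSemiring
    using (solve; _:+_; _:*_; _:=_)

  Seq : Set c
  Seq = ℕ → Carrier

  infix 4 _≋_
  _≋_ : Seq → Seq → Set ℓ
  f ≋ g = ∀ n → f n ≈ g n

  infixl 7 _⊛_
  _⊛_ : Seq → Seq → Seq
  (f ⊛ g) zero = f 0 * g 0
  (f ⊛ g) (suc n) = f 0 * g (suc n) + ((f ∘ suc) ⊛ g) n

  δ : Seq
  δ zero = 1#
  δ (suc _) = 0#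

  -- The bounds i ≤ n are what later allows infinitely many variables to be truncated to finitely
  -- many.
  ⊛-cong-≤ : ∀ {f f′ g g′} n → (∀ i → i ℕ.≤ n → f i ≈ f′ i) →
             (∀ i → i ℕ.≤ n → g i ≈ g′ i) → (f ⊛ g) n ≈ (f′ ⊛ g′) n
  ⊛-cong-≤ zero p q = *-cong (p 0 z≤n) (q 0 z≤n)
  ⊛-cong-≤ (suc n) p q =
    +-cong (*-cong (p 0 z≤n) (q (suc n) ℕₚ.≤-refl))
           (⊛-cong-≤ n (λ i i≤n → p (suc i) (s≤s i≤n)) (λ i i≤n → q i (ℕₚ.m≤n⇒m≤1+n i≤n)))

  ⊛-cong : ∀ {f f′ g g′} → f ≋ f′ → g ≋ g′ → f ⊛ g ≋ f′ ⊛ g′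
  ⊛-cong p q n = ⊛-cong-≤ n (λ i _ → p i) (λ i _ → q i)

  ⊛-distribʳ : ∀ g f f′ n → ((λ i → f i + f′ i) ⊛ g) n ≈ (f ⊛ g) n + (f′ ⊛ g) n
  ⊛-distribʳ g f f′ zero = distribʳ (g 0) (f 0) (f′ 0)
  ⊛-distribʳ g f f′ (suc n) = begin
    (f 0 + f′ 0) * g (suc n) + _
      ≈⟨ +-congˡ (⊛-distribʳ g (f ∘ suc) (f′ ∘ suc) n) ⟩
    (f 0 + f′ 0) * g (suc n) + (((f ∘ suc) ⊛ g) n + ((f′ ∘ suc) ⊛ g) n)
      ≈⟨ solve 5 (λ a b x u v → ((a :+ b) :* x :+ (u :+ v)) := (a :* x :+ u :+ (b :* x :+ v)))
           refl (f 0) (f′ 0) (g (suc n)) _ _ ⟩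
    _ ∎

  ⊛-scaleˡ : ∀ a f g n → ((λ i → a * f i) ⊛ g) n ≈ a * (f ⊛ g) n
  ⊛-scaleˡ a f g zero = *-assoc a (f 0) (g 0)
  ⊛-scaleˡ a f g (suc n) = begin
    a * f 0 * g (suc n) + _   ≈⟨ +-congˡ (⊛-scaleˡ a (f ∘ suc) g n) ⟩
    a * f 0 * g (suc n) + a * ((f ∘ suc) ⊛ g) n
      ≈⟨ solve 4 (λ a x y u → (a :* x :* y :+ a :* u) := (a :* (x :* y :+ u)))
           refl a (f 0) (g (suc n)) _ ⟩
    _ ∎

  ⊛-zeroˡ : ∀ g n → ((λ _ → 0#) ⊛ g) n ≈ 0#
  ⊛-zeroˡ g zero = zeroˡ (g 0)
  ⊛-zeroˡ g (suc n) = trans (+-cong (zeroˡ (g (suc n))) (⊛-zeroˡ g n)) (+-identityˡ 0#)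

  ⊛-identityˡ : ∀ f → δ ⊛ f ≋ f
  ⊛-identityˡ f zero = *-identityˡ (f 0)
  ⊛-identityˡ f (suc n) = trans (+-cong (*-identityˡ (f (suc n))) (⊛-zeroˡ f n)) (+-identityʳ _)

  -- The definition peels coefficients off the left factor; peeling them off the right one turns
  -- commutativity into an induction.
  ⊛-suc : ∀ f g n → (f ⊛ g) (suc n) ≈ f (suc n) * g 0 + (f ⊛ (g ∘ suc)) n
  ⊛-suc f g zero = +-comm _ _
  ⊛-suc f g (suc n) = begin
    f 0 * g (suc (suc n)) + ((f ∘ suc) ⊛ g) (suc n)
      ≈⟨ +-congˡ (⊛-suc (f ∘ suc) g n) ⟩
    f 0 * g (suc (suc n)) + (f (suc (suc n)) * g 0 + ((f ∘ suc) ⊛ (g ∘ suc)) n)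
      ≈⟨ solve 3 (λ x y z → (x :+ (y :+ z)) := (y :+ (x :+ z))) refl _ _ _ ⟩
    _ ∎

  ⊛-comm : ∀ f g → f ⊛ g ≋ g ⊛ f
  ⊛-comm f g zero = *-comm (f 0) (g 0)
  ⊛-comm f g (suc n) = begin
    f 0 * g (suc n) + ((f ∘ suc) ⊛ g) n ≈⟨ +-cong (*-comm _ _) (⊛-comm (f ∘ suc) g n) ⟩
    g (suc n) * f 0 + (g ⊛ (f ∘ suc)) n ≈⟨ ⊛-suc g f n ⟨
    (g ⊛ f) (suc n) ∎

  ⊛-assoc : ∀ f g h → (f ⊛ g) ⊛ h ≋ f ⊛ (g ⊛ h)
  ⊛-assoc f g h zero = *-assoc _ _ _
  ⊛-assoc f g h (suc n) = begin
    f 0 * g 0 * h (suc n) + ((λ i → f 0 * g (suc i) + ((f ∘ suc) ⊛ g) i) ⊛ h) n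
      ≈⟨ +-congˡ (⊛-distribʳ h _ _ n) ⟩
    f 0 * g 0 * h (suc n) + (((λ i → f 0 * g (suc i)) ⊛ h) n + (((f ∘ suc) ⊛ g) ⊛ h) n)
      ≈⟨ +-congˡ (+-cong (⊛-scaleˡ (f 0) (g ∘ suc) h n) (⊛-assoc (f ∘ suc) g h n)) ⟩
    f 0 * g 0 * h (suc n) + (f 0 * ((g ∘ suc) ⊛ h) n + ((f ∘ suc) ⊛ (g ⊛ h)) n)
      ≈⟨ solve 5 (λ a b x u v → (a :* b :* x :+ (a :* u :+ v)) := (a :* (b :* x :+ u) :+ v))
           refl (f 0) (g 0) (h (suc n)) _ _ ⟩
    _ ∎

  -- This lets the construction be iterated: Newton's identity multiplies sequences indexed by the
  -- degree m whose terms are themselves series in x.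
  seriesRing : CommutativeRing c ℓ
  seriesRing = record
    { Carrier = Seq
    ; _≈_ = _≋_
    ; _+_ = λ f g n → f n + g n
    ; _*_ = _⊛_
    ; -_ = λ f n → - f n
    ; 0# = λ _ → 0#
    ; 1# = δ
    ; isCommutativeRing = record
      { isRing = record
        { +-isAbelianGroup = record
          { isGroup = record
            { isMonoid = record
              { isSemigroup = record
                { isMagma = record
                  { isEquivalence = record
                    { refl = λ _ → refl
                    ; sym = λ p n → sym (p n)
                    ; trans = λ p q n → trans (p n) (q n)
                    }
                  ; ∙-cong = λ p q n → +-cong (p n) (q n)
                  }
                ; assoc = λ f g h n → +-assoc (f n) (g n) (h n)
                }
              ; identity = (λ f n → +-identityˡ (f n)) , (λ f n → +-identityʳ (f n))
              }
            ; inverse = (λ f n → -‿inverseˡ (f n)) , (λ f n → -‿inverseʳ (f n))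
            ; ⁻¹-cong = λ p n → -‿cong (p n)
            }
          ; comm = λ f g n → +-comm (f n) (g n)
          }
        ; *-cong = ⊛-cong
        ; *-assoc = ⊛-assoc
        ; *-identity = ⊛-identityˡ , λ f n → trans (⊛-comm f δ n) (⊛-identityˡ f n)
        ; distrib = (λ f g h n → trans (⊛-comm f _ n)
                       (trans (⊛-distribʳ f g h n) (+-cong (⊛-comm g f n) (⊛-comm h f n))))
                  , ⊛-distribʳ
        }
      ; *-comm = ⊛-comm
      }
    }

-- Newton's identity

module Symmetric {c ℓ} (R : CommutativeRing c ℓ) where
  open CommutativeRing R
  open SetoidReasoning setoid
  open import Algebra.Solver.Ring.NaturalCoefficients.Default commutativeSemiring
    using (solve; _:+_; _:*_; _:=_)
  open Series R
  open import Algebra.Properties.CommutativeMonoid.Mult +-commutativeMonoid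
    using (_×_; ×-congʳ; ×-distrib-+)
  open import Algebra.Properties.Semiring.Mult semiring using (×-comm-*)
  open import Algebra.Properties.Semiring.Exp semiring using (_^_)

  -- Monomials are split by whether the last variable `y N` occurs. For Σ hₘ tᵐ this adjoins a
  -- factor 1 / (1 - y_N t).
  complete : (ℕ → Carrier) → ℕ → Seq
  complete y N zero = 1#
  complete y zero (suc m) = 0#
  complete y (suc N) (suc m) = complete y N (suc m) + y N * complete y (suc N) m

  -- Entry i is pᵢ₊₁; with this shift the sum in Newton's identity is a plain Cauchy product.
  powerSum : (ℕ → Carrier) → ℕ → Seq
  powerSum y zero i = 0#
  powerSum y (suc N) i = powerSum y N i + y N ^ suc i

  module _ (y : Carrier) {h h′ : Seq} (h₀ : h 0 ≈ h′ 0)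
           (step : ∀ m → h (suc m) ≈ h′ (suc m) + y * h m) where

    -- For the series H and H′ of h and h′ in a variable t, the module hypotheses say H = H′ + y t
    -- H; multiply by the series of p.
    ⊛-adjoin : ∀ p m → (p ⊛ h) (suc m) ≈ (p ⊛ h′) (suc m) + y * (p ⊛ h) m
    ⊛-adjoin p zero = begin
      p 0 * h 1 + p 1 * h 0 ≈⟨ +-cong (*-congˡ (step 0)) (*-congˡ h₀) ⟩
      p 0 * (h′ 1 + y * h 0) + p 1 * h′ 0
        ≈⟨ solve 5 (λ a x y b c → (a :* (x :+ y :* b) :+ c) := (a :* x :+ c :+ y :* (a :* b)))
             refl (p 0) (h′ 1) y (h 0) _ ⟩
      _ ∎
    ⊛-adjoin p (suc m) = begin
      p 0 * h (suc (suc m)) + ((p ∘ suc) ⊛ h) (suc m)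
        ≈⟨ +-cong (*-congˡ (step (suc m))) (⊛-adjoin (p ∘ suc) m) ⟩
      p 0 * (h′ (suc (suc m)) + y * h (suc m)) +
        (((p ∘ suc) ⊛ h′) (suc m) + y * ((p ∘ suc) ⊛ h) m)
        ≈⟨ solve 6 (λ a x y b c d → (a :* (x :+ y :* b) :+ (c :+ y :* d)) :=
                                     (a :* x :+ c :+ y :* (a :* b :+ d)))
             refl (p 0) (h′ (suc (suc m))) y (h (suc m)) _ _ ⟩
      _ ∎

    -- Logarithmic differentiation in t: as H = H′ / (1 - y t), the logarithmic derivative of H
    -- exceeds that of H′ by y / (1 - y t) = Σ yⁱ⁺¹ tⁱ. The induction on m avoids the division.
    newton-adjoin : (p : Seq) → (∀ m → suc m × h′ (suc m) ≈ (p ⊛ h′) m) →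
      ∀ m → suc m × h (suc m) ≈ ((λ i → p i + y ^ suc i) ⊛ h) m
    newton-adjoin p ih zero = begin
      h 1 + 0#                     ≈⟨ +-congʳ (step 0) ⟩
      h′ 1 + y * h 0 + 0#
        ≈⟨ solve 3 (λ x y z → (x :+ y :+ z) := ((x :+ z) :+ y)) refl _ _ _ ⟩
      (h′ 1 + 0#) + y * h 0        ≈⟨ +-cong (ih 0) (*-congʳ (sym (*-identityʳ y))) ⟩
      p 0 * h′ 0 + y * 1# * h 0    ≈⟨ +-congʳ (*-congˡ (sym h₀)) ⟩
      p 0 * h 0 + y * 1# * h 0     ≈⟨ distribʳ _ _ _ ⟨
      (p 0 + y * 1#) * h 0         ∎
    newton-adjoin p ih (suc m) = begin
      suc (suc m) × h (suc (suc m))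
        ≈⟨ ×-congʳ (suc (suc m)) (step (suc m)) ⟩
      suc (suc m) × (h′ (suc (suc m)) + y * h (suc m))
        ≈⟨ ×-distrib-+ _ _ (suc (suc m)) ⟩
      suc (suc m) × h′ (suc (suc m)) + (y * h (suc m) + suc m × (y * h (suc m)))
        ≈⟨ +-cong (ih (suc m)) (+-congˡ (trans (sym (×-comm-* (suc m) y _)) (*-congˡ (newton-adjoin p ih m)))) ⟩
      (p ⊛ h′) (suc m) + (y * h (suc m) + y * ((λ i → p i + y ^ suc i) ⊛ h) m)
        ≈⟨ +-congˡ (+-congˡ (*-congˡ (⊛-distribʳ h p (λ i → y ^ suc i) m))) ⟩
      (p ⊛ h′) (suc m) + (y * h (suc m) + y * ((p ⊛ h) m + ((λ i → y ^ suc i) ⊛ h) m))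
        ≈⟨ solve 5 (λ a y b c d → (a :+ (y :* b :+ y :* (c :+ d))) := (a :+ y :* c :+ (y :* b :+ y :* d)))
             refl _ y (h (suc m)) _ _ ⟩
      (p ⊛ h′) (suc m) + y * (p ⊛ h) m + (y * h (suc m) + y * ((λ i → y ^ suc i) ⊛ h) m)
        -- The geometric sequence yⁱ⁺¹, shifted by one, is y times itself, so the two remaining
        -- terms unfold its product with h.
        ≈⟨ +-cong (sym (⊛-adjoin p m))
                  (+-cong (*-congʳ (sym (*-identityʳ y))) (sym (⊛-scaleˡ y _ h m))) ⟩
      (p ⊛ h) (suc m) + ((λ i → y ^ suc i) ⊛ h) (suc m)
        ≈⟨ ⊛-distribʳ h p (λ i → y ^ suc i) (suc m) ⟨
      _ ∎

  newton : ∀ y N m → suc m × complete y N (suc m) ≈ (powerSum y N ⊛ complete y N) m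
  newton y zero m = trans (×-zero m) (sym (⊛-zeroˡ (complete y 0) m))
    where
    ×-zero : ∀ m → suc m × 0# ≈ 0#
    ×-zero zero = +-identityˡ 0#
    ×-zero (suc m) = trans (+-identityˡ _) (×-zero m)
  newton y (suc N) = newton-adjoin (y N) refl (λ _ → refl) (powerSum y N) (newton y N)

open import Data.Product using (Σ; ∃; _×_; proj₁; proj₂)
open import Data.Rational as ℚ
  using (ℚ; mkℚ; 0ℚ; 1ℚ; _+_; _*_; _-_; ∣_∣; toℚᵘ; Positive; NonNegative)
open import Relation.Binary.PropositionalEquality
open Series ℚₚ.+-*-commutativeRing
open Symmetric seriesRing
open +-*-Solver using (solve; _:+_; _:*_; _:-_; :-_; _:=_; con)
open import Algebra.Definitions.RawSemiring
  (Semiring.rawSemiring (CommutativeRing.semiring seriesRing)) using (_^_) renaming (_×_ to _·_)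

-- Quasipolynomials

Δ : ℕ → Seq → Seq
Δ c f n = f (c ℕ.+ n) - f n

-- Sequences whose generating function is a polynomial of degree < c s over (1 − xᶜ)ˢ: on each
-- residue class modulo c they are, from the very first term on, polynomials of degree < s.
data QuasiPoly (c : ℕ) : ℕ → Seq → Set where
  zeroSeq : ∀ {f} → (∀ n → f n ≡ 0ℚ) → QuasiPoly c 0 f
  step : ∀ {s f} → QuasiPoly c s (Δ c f) → QuasiPoly c (suc s) f

module _ {c : ℕ} where

  quasiPoly-cong : ∀ {s f g} → f ≋ g → QuasiPoly c s f → QuasiPoly c s g
  quasiPoly-cong p (zeroSeq q) = zeroSeq (λ n → trans (sym (p n)) (q n))
  quasiPoly-cong p (step q) = step (quasiPoly-cong (λ n → cong₂ _-_ (p (c ℕ.+ n)) (p n)) q)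

  quasiPoly-0 : ∀ s {f} → (∀ n → f n ≡ 0ℚ) → QuasiPoly c s f
  quasiPoly-0 zero p = zeroSeq p
  quasiPoly-0 (suc s) p = step (quasiPoly-0 s (λ n → cong₂ _-_ (p (c ℕ.+ n)) (p n)))

  quasiPoly-≤ : ∀ {s t f} → s ℕ.≤ t → QuasiPoly c s f → QuasiPoly c t f
  quasiPoly-≤ {t = t} z≤n (zeroSeq p) = quasiPoly-0 t p
  quasiPoly-≤ (s≤s s≤t) (step p) = step (quasiPoly-≤ s≤t p)

  quasiPoly-+ : ∀ {s f g} → QuasiPoly c s f → QuasiPoly c s g → QuasiPoly c s (λ n → f n + g n)
  quasiPoly-+ (zeroSeq p) (zeroSeq q) = zeroSeq (λ n → cong₂ _+_ (p n) (q n))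
  quasiPoly-+ {f = f} {g} (step p) (step q) = step (quasiPoly-cong
    (λ n → solve 4 (λ a b x y → (a :- b) :+ (x :- y) := (a :+ x) :- (b :+ y)) refl
             (f (c ℕ.+ n)) (f n) (g (c ℕ.+ n)) (g n))
    (quasiPoly-+ p q))

  quasiPoly-scale : ∀ {s f} a → QuasiPoly c s f → QuasiPoly c s (λ n → a * f n)
  quasiPoly-scale a (zeroSeq p) = zeroSeq (λ n → trans (cong (a *_) (p n)) (ℚₚ.*-zeroʳ a))
  quasiPoly-scale {f = f} a (step p) = step (quasiPoly-cong
    (λ n → solve 3 (λ a x y → a :* (x :- y) := a :* x :- a :* y) refl a (f (c ℕ.+ n)) (f n))
    (quasiPoly-scale a p))

  quasiPoly-shift : ∀ {s f} d → QuasiPoly c s f → QuasiPoly c s (λ n → f (d ℕ.+ n))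
  quasiPoly-shift d (zeroSeq p) = zeroSeq (λ n → p (d ℕ.+ n))
  quasiPoly-shift {f = f} d (step p) = step (quasiPoly-cong
    (λ n → cong (λ k → f k - f (d ℕ.+ n)) (exchange n))
    (quasiPoly-shift d p))
    where
    exchange : ∀ n → c ℕ.+ (d ℕ.+ n) ≡ d ℕ.+ (c ℕ.+ n)
    exchange n = trans (sym (ℕₚ.+-assoc c d n))
                       (trans (cong (ℕ._+ n) (ℕₚ.+-comm c d)) (ℕₚ.+-assoc d c n))

  Δ-product : ∀ f g → (λ n → Δ c f n * g (c ℕ.+ n) + f n * Δ c g n) ≋ Δ c (λ n → f n * g n)
  Δ-product f g n =
    solve 4 (λ a b x y → (a :- b) :* x :+ b :* (x :- y) := a :* x :- b :* y) refl
      (f (c ℕ.+ n)) (f n) (g (c ℕ.+ n)) (g n)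

  -- Orders exceed degrees by one, and degrees add. In the product rule `Δ-product` each summand has
  -- one factor of smaller order. This bounds the entrywise powers of `B k` that make up the power
  -- sums.
  quasiPoly-product : ∀ s t {f g} → QuasiPoly c (suc s) f → QuasiPoly c (suc t) g →
                      QuasiPoly c (suc (s ℕ.+ t)) (λ n → f n * g n)
  quasiPoly-product s t {f} {g} (step p) (step q) =
    step (quasiPoly-cong (Δ-product f g) (quasiPoly-+ (left s p) (right t q)))
    where
    left : ∀ s → QuasiPoly c s (Δ c f) →
           QuasiPoly c (s ℕ.+ t) (λ n → Δ c f n * g (c ℕ.+ n))
    left zero (zeroSeq p) = quasiPoly-0 t
      (λ n → trans (cong (_* g (c ℕ.+ n)) (p n)) (ℚₚ.*-zeroˡ (g (c ℕ.+ n))))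
    left (suc s) p = quasiPoly-product s t p (quasiPoly-shift {f = g} c (step q))
    right : ∀ t → QuasiPoly c t (Δ c g) → QuasiPoly c (s ℕ.+ t) (λ n → f n * Δ c g n)
    right zero (zeroSeq q) = quasiPoly-0 (s ℕ.+ 0)
      (λ n → trans (cong (f n *_) (q n)) (ℚₚ.*-zeroʳ (f n)))
    right (suc t) q = subst (λ k → QuasiPoly c k (λ n → f n * Δ c g n)) (sym (ℕₚ.+-suc s t))
      (quasiPoly-product s t {f} (step p) q)

  -- The first d coefficients of f are cut off; each contributes a fixed multiple of a shift of g,
  -- and r collects these.
  ⊛-shift : ∀ d f {s g} → QuasiPoly c s g → Σ Seq λ r →
            QuasiPoly c s r × (∀ n → (f ⊛ g) (d ℕ.+ n) ≡ ((λ i → f (d ℕ.+ i)) ⊛ g) n + r n)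
  ⊛-shift zero f {s} q =
    (λ _ → 0ℚ) , quasiPoly-0 s (λ _ → refl) , λ n → sym (ℚₚ.+-identityʳ _)
  ⊛-shift (suc d) f {s} {g} q with ⊛-shift d (f ∘ suc) q
  ... | r , qr , eq =
    (λ n → f 0 * g (suc d ℕ.+ n) + r n) ,
    quasiPoly-+ (quasiPoly-scale (f 0) (quasiPoly-shift (suc d) q)) qr ,
    λ n → trans (cong (f 0 * g (suc d ℕ.+ n) +_) (eq n))
      (solve 3 (λ x y z → x :+ (y :+ z) := y :+ (x :+ z)) refl
        (f 0 * g (suc d ℕ.+ n)) (((λ i → f (suc d ℕ.+ i)) ⊛ g) n) (r n))

  -- Fractions over (1 - xᶜ)ˢ and (1 - xᶜ)ᵗ multiply. By `⊛-shift`, the difference of the product is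
  -- `Δ c f ⊛ g` up to a sequence of order t, which permits induction on s.
  quasiPoly-⊛ : ∀ {s t f g} → QuasiPoly c s f → QuasiPoly c t g → QuasiPoly c (s ℕ.+ t) (f ⊛ g)
  quasiPoly-⊛ {t = t} {g = g} (zeroSeq p) q =
    quasiPoly-0 t (λ n → trans (⊛-cong {g = g} p (λ _ → refl) n) (⊛-zeroˡ g n))
  quasiPoly-⊛ {suc s} {t} {f} {g} (step p) q with ⊛-shift c f q
  ... | r , qr , eq = step (quasiPoly-cong Δ-⊛
      (quasiPoly-+ (quasiPoly-⊛ p q) (quasiPoly-≤ (ℕₚ.m≤n+m t s) qr)))
    where
    open ≡-Reasoning
    Δ-⊛ : (λ n → (Δ c f ⊛ g) n + r n) ≋ Δ c (f ⊛ g)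
    Δ-⊛ n = begin
      (Δ c f ⊛ g) n + r n
        ≡⟨ solve 3 (λ x y z → x :+ y := (x :+ z) :+ y :- z) refl
             ((Δ c f ⊛ g) n) (r n) ((f ⊛ g) n) ⟩
      (Δ c f ⊛ g) n + (f ⊛ g) n + r n - (f ⊛ g) n
        ≡⟨ cong (λ x → x + r n - (f ⊛ g) n) (⊛-distribʳ g (Δ c f) f n) ⟨
      ((λ i → Δ c f i + f i) ⊛ g) n + r n - (f ⊛ g) n
        ≡⟨ cong (λ x → x + r n - (f ⊛ g) n) (⊛-cong {g = g} Δ+ (λ _ → refl) n) ⟩
      ((λ i → f (c ℕ.+ i)) ⊛ g) n + r n - (f ⊛ g) n
        ≡⟨ cong (_- (f ⊛ g) n) (eq n) ⟨
      (f ⊛ g) (c ℕ.+ n) - (f ⊛ g) n ∎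
      where
      Δ+ : ∀ i → Δ c f i + f i ≡ f (c ℕ.+ i)
      Δ+ i = solve 2 (λ x y → x :- y :+ y := x) refl (f (c ℕ.+ i)) (f i)

-- The substitution of xⁱ for x in the generating function.
expand : (i : ℕ) .{{_ : NonZero i}} → Seq → Seq
expand i f n = if (n ℕ.% i) ℕ.≡ᵇ 0 then f (n ℕ./ i) else 0ℚ

quasiPoly-expand : ∀ i .{{_ : NonZero i}} {c s f} →
                   QuasiPoly c s f → QuasiPoly (c ℕ.* i) s (expand i f)
quasiPoly-expand i {f = f} (zeroSeq p) = zeroSeq expand-0
  where
  expand-0 : ∀ n → expand i f n ≡ 0ℚ
  expand-0 n with (n ℕ.% i) ℕ.≡ᵇ 0
  ... | true = p (n ℕ./ i)
  ... | false = refl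
quasiPoly-expand i {{i≢0}} {c} {f = f} (step p) = step (quasiPoly-cong Δ-expand (quasiPoly-expand i p))
  where
  Δ-expand : expand i (Δ c f) ≋ Δ (c ℕ.* i) (expand i f)
  Δ-expand n
    rewrite ℕ.%-remove-+ˡ {c ℕ.* i} n {i} (ℕ.n∣m*n c)
          | ℕ.+-distrib-/-∣ˡ {c ℕ.* i} n {i} (ℕ.n∣m*n c)
          | ℕ.m*n/n≡m c i {{i≢0}}
    with (n ℕ.% i) ℕ.≡ᵇ 0
  ... | true = refl
  ... | false = refl

-- The coefficients of 1 / (1 − x)ˢ.
B : ℕ → Seq
B zero = δ
B (suc s) = (λ _ → 1ℚ) ⊛ B s

B-+ : ∀ s t → B s ⊛ B t ≋ B (s ℕ.+ t)
B-+ zero t = ⊛-identityˡ (B t)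
B-+ (suc s) t n = trans (⊛-assoc (λ _ → 1ℚ) (B s) (B t) n) (⊛-cong (λ _ → refl) (B-+ s t) n)

quasiPoly-1 : ∀ c → QuasiPoly c 1 (λ _ → 1ℚ)
quasiPoly-1 c = step (zeroSeq (λ n → refl))

-- Not an instance of `quasiPoly-⊛` at s = 0: `B 0` is `δ`, which for c > 0 is not a quasipolynomial
-- from its first term on.
quasiPoly-B⊛ : ∀ {c t g} s → QuasiPoly c t g → QuasiPoly c (s ℕ.+ t) (B s ⊛ g)
quasiPoly-B⊛ {g = g} zero q = quasiPoly-cong (λ n → sym (⊛-identityˡ g n)) q
quasiPoly-B⊛ {c} {g = g} (suc s) q = quasiPoly-cong
  (λ n → sym (⊛-assoc (λ _ → 1ℚ) (B s) g n))
  (quasiPoly-⊛ (quasiPoly-1 c) (quasiPoly-B⊛ s q))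

B-1 : ∀ n → B 1 n ≡ 1ℚ
B-1 n = trans (⊛-comm (λ _ → 1ℚ) δ n) (⊛-identityˡ (λ _ → 1ℚ) n)

quasiPoly-B : ∀ c s → QuasiPoly c (suc s) (B (suc s))
quasiPoly-B c zero = quasiPoly-cong (λ n → sym (B-1 n)) (quasiPoly-1 c)
quasiPoly-B c (suc s) = quasiPoly-⊛ (quasiPoly-1 c) (quasiPoly-B c s)

-- Rational arithmetic and polynomials

toℚᵘ-ℕtoℚ : ∀ m → toℚᵘ (ℕtoℚ m) ℚᵘ.≃ mkℚᵘ (ℤ.+ m) 0
toℚᵘ-ℕtoℚ m = ℚₚ.toℚᵘ-fromℚᵘ (mkℚᵘ (ℤ.+ m) 0)

ℕtoℚ-+ : ∀ m n → ℕtoℚ (m ℕ.+ n) ≡ ℕtoℚ m + ℕtoℚ n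
ℕtoℚ-+ m n = ℚₚ.toℚᵘ-injective (begin
  toℚᵘ (ℕtoℚ (m ℕ.+ n))                  ≈⟨ toℚᵘ-ℕtoℚ (m ℕ.+ n) ⟩
  mkℚᵘ (ℤ.+ (m ℕ.+ n)) 0
    ≈⟨ ℚᵘ.*≡* (cong (ℤ._* ℤ.1ℤ) (cong₂ ℤ._+_ (sym (ℤₚ.*-identityʳ (ℤ.+ m))) (sym (ℤₚ.*-identityʳ (ℤ.+ n))))) ⟩
  mkℚᵘ (ℤ.+ m) 0 ℚᵘ.+ mkℚᵘ (ℤ.+ n) 0     ≈⟨ ℚᵘₚ.+-cong (toℚᵘ-ℕtoℚ m) (toℚᵘ-ℕtoℚ n) ⟨
  toℚᵘ (ℕtoℚ m) ℚᵘ.+ toℚᵘ (ℕtoℚ n)       ≈⟨ ℚₚ.toℚᵘ-homo-+ (ℕtoℚ m) (ℕtoℚ n) ⟨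
  toℚᵘ (ℕtoℚ m + ℕtoℚ n)                 ∎)
  where open ℚᵘₚ.≃-Reasoning

ℕtoℚ-* : ∀ m n → ℕtoℚ (m ℕ.* n) ≡ ℕtoℚ m * ℕtoℚ n
ℕtoℚ-* m n = ℚₚ.toℚᵘ-injective (begin
  toℚᵘ (ℕtoℚ (m ℕ.* n))                  ≈⟨ toℚᵘ-ℕtoℚ (m ℕ.* n) ⟩
  mkℚᵘ (ℤ.+ (m ℕ.* n)) 0                 ≈⟨ ℚᵘ.*≡* (cong (ℤ._* ℤ.1ℤ) (ℤₚ.pos-* m n)) ⟩
  mkℚᵘ (ℤ.+ m) 0 ℚᵘ.* mkℚᵘ (ℤ.+ n) 0     ≈⟨ ℚᵘₚ.*-cong (toℚᵘ-ℕtoℚ m) (toℚᵘ-ℕtoℚ n) ⟨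
  toℚᵘ (ℕtoℚ m) ℚᵘ.* toℚᵘ (ℕtoℚ n)       ≈⟨ ℚₚ.toℚᵘ-homo-* (ℕtoℚ m) (ℕtoℚ n) ⟨
  toℚᵘ (ℕtoℚ m * ℕtoℚ n)                 ∎)
  where open ℚᵘₚ.≃-Reasoning

ℕtoℚ-mono-≤ : ∀ {m n} → m ℕ.≤ n → ℕtoℚ m ℚ.≤ ℕtoℚ n
ℕtoℚ-mono-≤ {m} {n} m≤n = ℚₚ.toℚᵘ-cancel-≤ (begin
  toℚᵘ (ℕtoℚ m)   ≃⟨ toℚᵘ-ℕtoℚ m ⟩
  mkℚᵘ (ℤ.+ m) 0  ≤⟨ ℚᵘ.*≤* (ℤₚ.*-monoʳ-≤-nonNeg (ℤ.+ 1) (ℤ.+≤+ m≤n)) ⟩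
  mkℚᵘ (ℤ.+ n) 0  ≃⟨ toℚᵘ-ℕtoℚ n ⟨
  toℚᵘ (ℕtoℚ n)   ∎)
  where open ℚᵘₚ.≤-Reasoning

<-ℕtoℚ : ∀ p → ∃ λ n → p ℚ.< ℕtoℚ n
<-ℕtoℚ p@(mkℚ a d _) = suc ℤ.∣ a ∣ , ℚₚ.toℚᵘ-cancel-< (begin-strict
  mkℚᵘ a d                     <⟨ ℚᵘ.*<* (numerators a) ⟩
  mkℚᵘ (ℤ.+ suc ℤ.∣ a ∣) 0   ≃⟨ toℚᵘ-ℕtoℚ (suc ℤ.∣ a ∣) ⟨
  toℚᵘ (ℕtoℚ (suc ℤ.∣ a ∣))    ∎)
  where
  open ℚᵘₚ.≤-Reasoning
  numerators : ∀ a → a ℤ.* ℤ.1ℤ ℤ.< ℤ.+ suc ℤ.∣ a ∣ ℤ.* ℤ.+ suc d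
  numerators (ℤ.+ n) = subst₂ ℤ._<_ (sym (ℤₚ.*-identityʳ (ℤ.+ n))) (ℤₚ.pos-* (suc n) (suc d))
    (ℤ.+<+ (ℕₚ.m≤m*n (suc n) (suc d)))
  numerators -[1+ n ] = ℤ.-<+

<-*ℕtoℚ : ∀ p ε → 0ℚ ℚ.< ε → ∃ λ n → p ℚ.< ε * ℕtoℚ n
<-*ℕtoℚ p ε 0<ε = scaled (<-ℕtoℚ (ℚ.1/ ε * p))
  where
  instance
    ε-pos : Positive ε
    ε-pos = ℚ.positive 0<ε
    ε-nonZero : ℚ.NonZero ε
    ε-nonZero = ℚₚ.pos⇒nonZero ε
  cancel : ε * (ℚ.1/ ε * p) ≡ p
  cancel = trans (sym (ℚₚ.*-assoc ε (ℚ.1/ ε) p))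
                 (trans (cong (_* p) (ℚₚ.*-inverseʳ ε)) (ℚₚ.*-identityˡ p))
  scaled : (∃ λ n → ℚ.1/ ε * p ℚ.< ℕtoℚ n) → ∃ λ n → p ℚ.< ε * ℕtoℚ n
  scaled (n , lt) = n , subst (ℚ._< ε * ℕtoℚ n) cancel (ℚₚ.*-monoʳ-<-pos ε lt)

ℕtoℚ-suc-nonZero : ∀ m → ℚ.NonZero (ℕtoℚ (suc m))
ℕtoℚ-suc-nonZero m = ℚₚ.pos⇒nonZero (ℕtoℚ (suc m)) {{ℚₚ.normalize-pos (suc m) 1}}

-- 1 / (m + 1), so that no nonzero argument is needed.
recip : ℕ → ℚ
recip m = ℚ.1/_ (ℕtoℚ (suc m)) {{ℕtoℚ-suc-nonZero m}}

recip-inverse : ∀ m → recip m * ℕtoℚ (suc m) ≡ 1ℚ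
recip-inverse m = ℚₚ.*-inverseˡ (ℕtoℚ (suc m)) {{ℕtoℚ-suc-nonZero m}}

invFact : ℕ → ℚ
invFact zero = 1ℚ
invFact (suc m) = recip m * invFact m

invFact-inverse : ∀ m → invFact m * ℕtoℚ (m !) ≡ 1ℚ
invFact-inverse zero = refl
invFact-inverse (suc m) = begin
  recip m * invFact m * ℕtoℚ (suc m ℕ.* m !)
    ≡⟨ cong ((recip m * invFact m) *_) (ℕtoℚ-* (suc m) (m !)) ⟩
  recip m * invFact m * (ℕtoℚ (suc m) * ℕtoℚ (m !))
    ≡⟨ solve 4 (λ a b c d → a :* b :* (c :* d) := (a :* c) :* (b :* d)) refl
         (recip m) (invFact m) (ℕtoℚ (suc m)) (ℕtoℚ (m !)) ⟩
  (recip m * ℕtoℚ (suc m)) * (invFact m * ℕtoℚ (m !))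
    ≡⟨ cong₂ _*_ (recip-inverse m) (invFact-inverse m) ⟩
  1ℚ ∎
  where open ≡-Reasoning

mutual
  -- For s > 0, `B s t` is the binomial coefficient of t + s - 1 over t; this and `B-step` are its
  -- absorption identities. Pascal's rule, which is the recursion of `B`, reduces each of them to
  -- both at smaller arguments.
  B-raise : ∀ s t → ℕtoℚ s * B (suc s) t ≡ (ℕtoℚ t + ℕtoℚ s) * B s t
  B-raise s zero = cong₂ _*_ (sym (ℚₚ.+-identityˡ (ℕtoℚ s))) (ℚₚ.*-identityˡ (B s 0))
  B-raise s (suc t) rewrite ℕtoℚ-+ 1 t = begin
    σ * (1ℚ * B s (suc t) + B (suc s) t)
      ≡⟨ solve 3 (λ σ b c → σ :* (con 1ℚ :* b :+ c) := σ :* b :+ σ :* c) refl σ (B s (suc t)) (B (suc s) t) ⟩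
    σ * B s (suc t) + σ * B (suc s) t
      ≡⟨ cong ((σ * B s (suc t)) +_) (trans (B-raise s t) (sym (B-step s t))) ⟩
    σ * B s (suc t) + (1ℚ + ℕtoℚ t) * B s (suc t)
      ≡⟨ solve 3 (λ σ τ b → σ :* b :+ (con 1ℚ :+ τ) :* b := (con 1ℚ :+ τ :+ σ) :* b) refl σ (ℕtoℚ t) (B s (suc t)) ⟩
    (1ℚ + ℕtoℚ t + σ) * B s (suc t) ∎
    where
    open ≡-Reasoning
    σ = ℕtoℚ s

  B-step : ∀ s t → (1ℚ + ℕtoℚ t) * B s (suc t) ≡ (ℕtoℚ t + ℕtoℚ s) * B s t
  B-step zero zero = refl
  B-step zero (suc t) = trans (ℚₚ.*-zeroʳ (1ℚ + ℕtoℚ (suc t))) (sym (ℚₚ.*-zeroʳ (ℕtoℚ (suc t) + 0ℚ)))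
  B-step (suc s) t rewrite ℕtoℚ-+ 1 s = begin
    (1ℚ + τ) * (1ℚ * B s (suc t) + B (suc s) t)
      ≡⟨ solve 3 (λ τ b c → (con 1ℚ :+ τ) :* (con 1ℚ :* b :+ c) := (con 1ℚ :+ τ) :* b :+ (con 1ℚ :+ τ) :* c)
           refl τ (B s (suc t)) (B (suc s) t) ⟩
    (1ℚ + τ) * B s (suc t) + (1ℚ + τ) * B (suc s) t
      ≡⟨ cong (_+ ((1ℚ + τ) * B (suc s) t)) (trans (B-step s t) (sym (B-raise s t))) ⟩
    ℕtoℚ s * B (suc s) t + (1ℚ + τ) * B (suc s) t
      ≡⟨ solve 3 (λ σ τ c → σ :* c :+ (con 1ℚ :+ τ) :* c := (τ :+ (con 1ℚ :+ σ)) :* c) refl (ℕtoℚ s) τ (B (suc s) t) ⟩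
    (τ + (1ℚ + ℕtoℚ s)) * B (suc s) t ∎
    where
    open ≡-Reasoning
    τ = ℕtoℚ t

-- The coefficients of k + (α x + β) c(x).
mulLinear : ∀ {n} → ℚ → ℚ → ℚ → Vec ℚ n → Vec ℚ (suc n)
mulLinear α β k [] = k ∷ []
mulLinear α β k (c ∷ cs) = (k + β * c) ∷ mulLinear α β (α * c) cs

eval-mulLinear : ∀ {n} α β k (c : Vec ℚ n) x →
                 evalPoly (mulLinear α β k c) x ≡ k + (α * x + β) * evalPoly c x
eval-mulLinear α β k [] x =
  solve 3 (λ k x y → k :+ x :* con 0ℚ := k :+ y :* con 0ℚ) refl k x (α * x + β)
eval-mulLinear α β k (c ∷ cs) x rewrite eval-mulLinear α β (α * c) cs x =
  solve 6 (λ α β k c x e → k :+ β :* c :+ x :* (α :* c :+ (α :* x :+ β) :* e) :=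
                           k :+ (α :* x :+ β) :* (c :+ x :* e))
    refl α β k c x (evalPoly cs x)

last-mulLinear : ∀ {n} α β k (c : Vec ℚ (suc n)) →
                 Vec.last (mulLinear α β k c) ≡ α * Vec.last c
last-mulLinear α β k (c ∷ []) = refl
last-mulLinear α β k (c ∷ cs@(_ ∷ _)) = last-mulLinear α β (α * c) cs

eval-add : ∀ {n} (c d : Vec ℚ n) x →
           evalPoly (Vec.zipWith _+_ c d) x ≡ evalPoly c x + evalPoly d x
eval-add [] [] x = refl
eval-add (a ∷ c) (b ∷ d) x rewrite eval-add c d x =
  solve 5 (λ a b x u v → a :+ b :+ x :* (u :+ v) := a :+ x :* u :+ (b :+ x :* v))
    refl a b x (evalPoly c x) (evalPoly d x)

last-add : ∀ {n} (c d : Vec ℚ (suc n)) →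
           Vec.last (Vec.zipWith _+_ c d) ≡ Vec.last c + Vec.last d
last-add (a ∷ []) (b ∷ []) = refl
last-add (_ ∷ c@(_ ∷ _)) (_ ∷ d@(_ ∷ _)) = last-add c d

eval-scale : ∀ {n} a (c : Vec ℚ n) x → evalPoly (Vec.map (a *_) c) x ≡ a * evalPoly c x
eval-scale a [] x = sym (ℚₚ.*-zeroʳ a)
eval-scale a (b ∷ c) x rewrite eval-scale a c x =
  solve 4 (λ a b x u → a :* b :+ x :* (a :* u) := a :* (b :+ x :* u)) refl a b x (evalPoly c x)

last-scale : ∀ {n} a (c : Vec ℚ (suc n)) → Vec.last (Vec.map (a *_) c) ≡ a * Vec.last c
last-scale a (b ∷ []) = refl
last-scale a (_ ∷ c@(_ ∷ _)) = last-scale a c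

eval-pad : ∀ {n} (c : Vec ℚ n) x → evalPoly (c Vec.∷ʳ 0ℚ) x ≡ evalPoly c x
eval-pad [] x = trans (ℚₚ.+-identityˡ (x * 0ℚ)) (ℚₚ.*-zeroʳ x)
eval-pad (a ∷ c) x = cong (λ e → a + x * e) (eval-pad c x)

last-pad : ∀ {n} (c : Vec ℚ n) → Vec.last (c Vec.∷ʳ 0ℚ) ≡ 0ℚ
last-pad [] = refl
last-pad (_ ∷ []) = refl
last-pad (_ ∷ c@(_ ∷ _)) = last-pad c

-- This is (z + 1) ⋯ (z + s) / s! at z = α x + β. The affine substitution is built in because a
-- component arises as a polynomial in the quotient of G by the period but has to be one in G.
binomPoly : ℚ → ℚ → ∀ s → Vec ℚ (suc s)
binomPoly α β zero = 1ℚ ∷ []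
binomPoly α β (suc s) = mulLinear (recip s * α) (recip s * (β + ℕtoℚ (suc s))) 0ℚ (binomPoly α β s)

eval-binomPoly : ∀ α β s {t x} → α * x + β ≡ ℕtoℚ t → evalPoly (binomPoly α β s) x ≡ B (suc s) t
eval-binomPoly α β zero {t} {x} eq =
  trans (solve 1 (λ x → con 1ℚ :+ x :* con 0ℚ := con 1ℚ) refl x) (sym (B-1 t))
eval-binomPoly α β (suc s) {t} {x} eq = begin
  evalPoly (binomPoly α β (suc s)) x
    ≡⟨ eval-mulLinear (recip s * α) (recip s * (β + ℕtoℚ (suc s))) 0ℚ (binomPoly α β s) x ⟩
  0ℚ + (recip s * α * x + recip s * (β + ℕtoℚ (suc s))) * evalPoly (binomPoly α β s) x
    ≡⟨ solve 6 (λ ρ α x β σ e → con 0ℚ :+ (ρ :* α :* x :+ ρ :* (β :+ σ)) :* e :=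
                                ρ :* ((α :* x :+ β :+ σ) :* e))
         refl (recip s) α x β (ℕtoℚ (suc s)) (evalPoly (binomPoly α β s) x) ⟩
  recip s * ((α * x + β + ℕtoℚ (suc s)) * evalPoly (binomPoly α β s) x)
    ≡⟨ cong₂ (λ u v → recip s * ((u + ℕtoℚ (suc s)) * v)) eq (eval-binomPoly α β s {t} {x} eq) ⟩
  recip s * ((ℕtoℚ t + ℕtoℚ (suc s)) * B (suc s) t)
    ≡⟨ cong (recip s *_) (B-raise (suc s) t) ⟨
  recip s * (ℕtoℚ (suc s) * B (suc (suc s)) t)
    ≡⟨ ℚₚ.*-assoc (recip s) (ℕtoℚ (suc s)) _ ⟨
  recip s * ℕtoℚ (suc s) * B (suc (suc s)) t
    ≡⟨ cong (_* B (suc (suc s)) t) (recip-inverse s) ⟩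
  1ℚ * B (suc (suc s)) t
    ≡⟨ ℚₚ.*-identityˡ (B (suc (suc s)) t) ⟩
  B (suc (suc s)) t ∎
  where open ≡-Reasoning

last-binomPoly : ∀ β s → Vec.last (binomPoly 1ℚ β s) ≡ invFact s
last-binomPoly β zero = refl
last-binomPoly β (suc s) =
  trans (last-mulLinear (recip s * 1ℚ) (recip s * (β + ℕtoℚ (suc s))) 0ℚ (binomPoly 1ℚ β s))
        (cong₂ _*_ (ℚₚ.*-identityʳ (recip s)) (last-binomPoly β s))

-- Polynomial components and limits

ΔB : ∀ s n → Δ 1 (B (suc s)) n ≡ B s (suc n)
ΔB s n = solve 2 (λ b c → con 1ℚ :* b :+ c :- c := b) refl (B s (suc n)) (B (suc s) n)

-- The s-th difference of f is a constant a, and that of `B (suc s)` is 1.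
quasiPoly-leading : ∀ s {f} → QuasiPoly 1 (suc s) f →
                    Σ ℚ λ a → QuasiPoly 1 s (λ n → f n - a * B (suc s) n)
quasiPoly-leading zero {f} (step (zeroSeq p)) = f 0 , zeroSeq vanishes
  where
  open ≡-Reasoning
  constant : ∀ n → f n ≡ f 0
  constant zero = refl
  constant (suc n) = begin
    f (suc n)               ≡⟨ solve 2 (λ x y → x := x :- y :+ y) refl (f (suc n)) (f n) ⟩
    f (suc n) - f n + f n   ≡⟨ cong₂ _+_ (p n) (constant n) ⟩
    0ℚ + f 0                ≡⟨ ℚₚ.+-identityˡ (f 0) ⟩
    f 0                     ∎
  vanishes : ∀ n → f n - f 0 * B 1 n ≡ 0ℚ
  vanishes n = trans (cong₂ (λ x y → x - f 0 * y) (constant n) (B-1 n))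
                     (solve 1 (λ x → x :- x :* con 1ℚ := con 0ℚ) refl (f 0))
quasiPoly-leading (suc s) {f} (step p) with quasiPoly-leading s p
-- By `ΔB` the difference produces `B (suc s)` at n + 1, while q has it at n; the gap is a multiple
-- of `Δ 1 (B (suc s))`, of order s only.
... | a , q = a , step (quasiPoly-cong difference (quasiPoly-+ q (quasiPoly-scale (ℚ.- a) ΔB-quasiPoly)))
  where
  open ≡-Reasoning
  ΔB-quasiPoly : QuasiPoly 1 s (Δ 1 (B (suc s)))
  ΔB-quasiPoly with quasiPoly-B 1 s
  ... | step r = r
  difference : ∀ n → Δ 1 f n - a * B (suc s) n + ℚ.- a * Δ 1 (B (suc s)) n
                   ≡ Δ 1 (λ n → f n - a * B (suc (suc s)) n) n
  difference n = begin
    Δ 1 f n - a * B (suc s) n + ℚ.- a * Δ 1 (B (suc s)) n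
      ≡⟨ solve 5 (λ x y a b c → x :- y :- a :* b :+ (:- a) :* (c :- b) :=
                                x :- y :- a :* c) refl (f (suc n)) (f n) a (B (suc s) n) (B (suc s) (suc n)) ⟩
    f (suc n) - f n - a * B (suc s) (suc n)
      ≡⟨ cong (λ c → f (suc n) - f n - a * c) (ΔB (suc s) n) ⟨
    f (suc n) - f n - a * (B (suc (suc s)) (suc n) - B (suc (suc s)) n)
      ≡⟨ solve 5 (λ x y a b c → x :- y :- a :* (b :- c) := x :- a :* b :- (y :- a :* c)) refl
           (f (suc n)) (f n) a (B (suc (suc s)) (suc n)) (B (suc (suc s)) n) ⟩
    Δ 1 (λ n → f n - a * B (suc (suc s)) n) n ∎

quasiPoly-eval : ∀ s {f} → QuasiPoly 1 s f → ∀ α β →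
  Σ (Vec ℚ s) λ c → ∀ t x → α * x + β ≡ ℕtoℚ t → f t ≡ evalPoly c x
quasiPoly-eval zero (zeroSeq p) α β = [] , λ t _ _ → p t
quasiPoly-eval (suc s) {f} p α β with quasiPoly-leading s p
... | a , q with quasiPoly-eval s q α β
... | c , eval-c = Vec.zipWith _+_ (c Vec.∷ʳ 0ℚ) (Vec.map (a *_) (binomPoly α β s)) , λ t x eq → begin
    f t
      ≡⟨ solve 2 (λ x y → x := x :- y :+ y) refl (f t) (a * B (suc s) t) ⟩
    f t - a * B (suc s) t + a * B (suc s) t
      ≡⟨ cong₂ _+_ (eval-c t x eq) (cong (a *_) (sym (eval-binomPoly α β s {t} {x} eq))) ⟩
    evalPoly c x + a * evalPoly (binomPoly α β s) x
      ≡⟨ cong₂ _+_ (eval-pad c x) (eval-scale a (binomPoly α β s) x) ⟨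
    evalPoly (c Vec.∷ʳ 0ℚ) x + evalPoly (Vec.map (a *_) (binomPoly α β s)) x
      ≡⟨ eval-add (c Vec.∷ʳ 0ℚ) (Vec.map (a *_) (binomPoly α β s)) x ⟨
    evalPoly (Vec.zipWith _+_ (c Vec.∷ʳ 0ℚ) (Vec.map (a *_) (binomPoly α β s))) x ∎
  where open ≡-Reasoning

quasiPoly-residue : ∀ {c s f} r → QuasiPoly c s f → QuasiPoly 1 s (λ t → f (t ℕ.* c ℕ.+ r))
quasiPoly-residue {c} r (zeroSeq p) = zeroSeq (λ t → p (t ℕ.* c ℕ.+ r))
quasiPoly-residue {c} {f = f} r (step p) = step (quasiPoly-cong
  (λ t → cong (λ k → f k - f (t ℕ.* c ℕ.+ r)) (sym (ℕₚ.+-assoc c (t ℕ.* c) r)))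
  (quasiPoly-residue r p))

quasiPoly-component : ∀ {q s f} → QuasiPoly (suc q) s f → (r : ℕ) →
  Σ (Vec ℚ s) λ c → ∀ t → f (t ℕ.* suc q ℕ.+ r) ≡ evalPoly c (ℕtoℚ (t ℕ.* suc q ℕ.+ r))
-- These α and β solve G = t (q + 1) + r for t.
quasiPoly-component {q} p r with quasiPoly-eval _ (quasiPoly-residue r p) (recip q) (ℚ.- (recip q * ℕtoℚ r))
... | c , eval-c = c , λ t → eval-c t (ℕtoℚ (t ℕ.* suc q ℕ.+ r)) (affine t)
  where
  open ≡-Reasoning
  affine : ∀ t → recip q * ℕtoℚ (t ℕ.* suc q ℕ.+ r) + ℚ.- (recip q * ℕtoℚ r) ≡ ℕtoℚ t
  affine t = begin
    recip q * ℕtoℚ (t ℕ.* suc q ℕ.+ r) - recip q * ℕtoℚ r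
      ≡⟨ cong (λ x → recip q * x - recip q * ℕtoℚ r)
           (trans (ℕtoℚ-+ (t ℕ.* suc q) r) (cong (_+ ℕtoℚ r) (ℕtoℚ-* t (suc q)))) ⟩
    recip q * (ℕtoℚ t * ℕtoℚ (suc q) + ℕtoℚ r) - recip q * ℕtoℚ r
      ≡⟨ solve 4 (λ ρ t q r → ρ :* (t :* q :+ r) :- ρ :* r := t :* (ρ :* q)) refl
           (recip q) (ℕtoℚ t) (ℕtoℚ (suc q)) (ℕtoℚ r) ⟩
    ℕtoℚ t * (recip q * ℕtoℚ (suc q))
      ≡⟨ trans (cong (ℕtoℚ t *_) (recip-inverse q)) (ℚₚ.*-identityʳ (ℕtoℚ t)) ⟩
    ℕtoℚ t ∎

-- The components of the difference have only D coefficients. Padded with 0, they leave the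
-- coefficient of G^D to the common term a · `B (suc D)`, where it is a / D!.
hasQuasiPolyLC : ∀ (H : ℕ → ℕ) D a q → QuasiPoly (suc q) D (λ G → ℕtoℚ (H G) - a * B (suc D) G) →
                 HasQuasiPolyLC H D (a * invFact D)
hasQuasiPolyLC H D a q p = q , P , last-P , eval-P
  where
  open ≡-Reasoning
  top : Vec ℚ (suc D)
  top = Vec.map (a *_) (binomPoly 1ℚ 0ℚ D)
  lower : Fin (suc q) → Vec ℚ D
  lower r = proj₁ (quasiPoly-component p (toℕ r))
  P : Fin (suc q) → Vec ℚ (suc D)
  P r = Vec.zipWith _+_ (lower r Vec.∷ʳ 0ℚ) top
  last-P : ∀ r → Vec.last (P r) ≡ a * invFact D
  last-P r = begin
    Vec.last (P r)                                 ≡⟨ last-add (lower r Vec.∷ʳ 0ℚ) top ⟩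
    Vec.last (lower r Vec.∷ʳ 0ℚ) + Vec.last top
      ≡⟨ cong₂ _+_ (last-pad (lower r)) (last-scale a (binomPoly 1ℚ 0ℚ D)) ⟩
    0ℚ + a * Vec.last (binomPoly 1ℚ 0ℚ D)
      ≡⟨ ℚₚ.+-identityˡ _ ⟩
    a * Vec.last (binomPoly 1ℚ 0ℚ D)               ≡⟨ cong (a *_) (last-binomPoly 0ℚ D) ⟩
    a * invFact D                                  ∎
  eval-lower : ∀ G → ℕtoℚ (H G) - a * B (suc D) G ≡ evalPoly (lower (G ℕ.mod suc q)) (ℕtoℚ G)
  eval-lower G = subst
    (λ k → ℕtoℚ (H k) - a * B (suc D) k ≡ evalPoly (lower (G ℕ.mod suc q)) (ℕtoℚ k))
    (sym (trans (ℕ.DivMod.property (G ℕ.divMod suc q)) (ℕₚ.+-comm (toℕ (G ℕ.mod suc q)) _)))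
    (proj₂ (quasiPoly-component p (toℕ (G ℕ.mod suc q))) (G ℕ./ suc q))
  eval-top : ∀ G → evalPoly top (ℕtoℚ G) ≡ a * B (suc D) G
  eval-top G = trans (eval-scale a (binomPoly 1ℚ 0ℚ D) (ℕtoℚ G))
    (cong (a *_) (eval-binomPoly 1ℚ 0ℚ D {G}
      (trans (ℚₚ.+-identityʳ _) (ℚₚ.*-identityˡ (ℕtoℚ G)))))
  eval-P : ∀ G → ℕtoℚ (H G) ≡ evalPoly (P (G ℕ.mod suc q)) (ℕtoℚ G)
  eval-P G = begin
    ℕtoℚ (H G)
      ≡⟨ solve 2 (λ x y → x := x :- y :+ y) refl (ℕtoℚ (H G)) (a * B (suc D) G) ⟩
    ℕtoℚ (H G) - a * B (suc D) G + a * B (suc D) G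
      ≡⟨ cong₂ _+_ (trans (eval-lower G) (sym (eval-pad (lower r) (ℕtoℚ G)))) (sym (eval-top G)) ⟩
    evalPoly (lower r Vec.∷ʳ 0ℚ) (ℕtoℚ G) + evalPoly top (ℕtoℚ G)
      ≡⟨ eval-add (lower r Vec.∷ʳ 0ℚ) top (ℕtoℚ G) ⟨
    evalPoly (P r) (ℕtoℚ G) ∎
    where r = G ℕ.mod suc q

1≤^ℚ : ∀ {x} d → 1ℚ ℚ.≤ x → 1ℚ ℚ.≤ x ^ℚ d
1≤^ℚ zero 1≤x = ℚₚ.≤-refl
1≤^ℚ {x} (suc d) 1≤x = ℚₚ.≤-trans 1≤x (subst (ℚ._≤ x * x ^ℚ d) (ℚₚ.*-identityʳ x)
  (ℚₚ.*-monoˡ-≤-nonNeg x {{ℚ.nonNegative (ℚₚ.≤-trans (ℚₚ.nonNegative⁻¹ 1ℚ) 1≤x)}} (1≤^ℚ d 1≤x)))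

-- The lower-order terms are O(x ^ (d − 1)) for x ≥ 1; the factor x avoids the exponent d − 1.
lowerTerms-bound : ∀ {d} (c : Vec ℚ (suc d)) → Σ ℚ λ K → ∀ x → 1ℚ ℚ.≤ x →
  ∣ evalPoly c x - Vec.last c * x ^ℚ d ∣ * x ℚ.≤ K * x ^ℚ d
lowerTerms-bound (a ∷ []) = 0ℚ , λ x _ → ℚₚ.≤-reflexive (begin
  ∣ a + x * 0ℚ - a * 1ℚ ∣ * x
    ≡⟨ cong (λ e → ∣ e ∣ * x) (solve 2 (λ a x → a :+ x :* con 0ℚ :- a :* con 1ℚ := con 0ℚ) refl a x) ⟩
  0ℚ * x                        ≡⟨ ℚₚ.*-zeroˡ x ⟩
  0ℚ                            ∎)
  where open ≡-Reasoning
lowerTerms-bound {suc d} (a ∷ c@(_ ∷ _)) with lowerTerms-bound c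
... | K , bound = ∣ a ∣ + K , bound′
  where
  open ℚₚ.≤-Reasoning
  bound′ : ∀ x → 1ℚ ℚ.≤ x →
           ∣ a + x * evalPoly c x - Vec.last c * (x * x ^ℚ d) ∣ * x ℚ.≤ (∣ a ∣ + K) * (x * x ^ℚ d)
  bound′ x 1≤x = begin
    ∣ a + x * e - l * (x * p) ∣ * x
      ≡⟨ cong (λ z → ∣ z ∣ * x) (solve 5 (λ a x e l p → a :+ x :* e :- l :* (x :* p) := a :+ x :* (e :- l :* p))
           refl a x e l p) ⟩
    ∣ a + x * (e - l * p) ∣ * x
      ≤⟨ ℚₚ.*-monoʳ-≤-nonNeg x (ℚₚ.∣p+q∣≤∣p∣+∣q∣ a (x * (e - l * p))) ⟩
    (∣ a ∣ + ∣ x * (e - l * p) ∣) * x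
      ≡⟨ cong (λ z → (∣ a ∣ + z) * x) (trans (ℚₚ.∣p*q∣≡∣p∣*∣q∣ x (e - l * p))
           (cong (_* ∣ e - l * p ∣) (ℚₚ.0≤p⇒∣p∣≡p 0≤x))) ⟩
    (∣ a ∣ + x * ∣ e - l * p ∣) * x
      ≡⟨ solve 3 (λ a x w → (a :+ x :* w) :* x := a :* (x :* con 1ℚ) :+ x :* (w :* x)) refl (∣ a ∣) x (∣ e - l * p ∣) ⟩
    ∣ a ∣ * (x * 1ℚ) + x * (∣ e - l * p ∣ * x)
      ≤⟨ ℚₚ.+-mono-≤
           (ℚₚ.*-monoˡ-≤-nonNeg (∣ a ∣) {{ℚₚ.∣-∣-nonNeg a}} (ℚₚ.*-monoˡ-≤-nonNeg x (1≤^ℚ d 1≤x)))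
           (ℚₚ.*-monoˡ-≤-nonNeg x (bound x 1≤x)) ⟩
    ∣ a ∣ * (x * p) + x * (K * p)
      ≡⟨ solve 4 (λ a x p k → a :* (x :* p) :+ x :* (k :* p) := (a :+ k) :* (x :* p)) refl (∣ a ∣) x p K ⟩
    (∣ a ∣ + K) * (x * p) ∎
    where
    e = evalPoly c x
    l = Vec.last c
    p = x ^ℚ d
    0≤x : 0ℚ ℚ.≤ x
    0≤x = ℚₚ.≤-trans (ℚₚ.nonNegative⁻¹ 1ℚ) 1≤x
    instance
      x-nonNeg : NonNegative x
      x-nonNeg = ℚ.nonNegative 0≤x

upperBound : ∀ {n} (K : Fin n → ℚ) → ∃ λ M → ∀ r → K r ℚ.≤ M
upperBound {zero} K = 0ℚ , λ ()
upperBound {suc n} K with upperBound (K ∘ Fin.suc)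
... | M , K≤M = K Fin.zero ℚ.⊔ M , λ where
  Fin.zero → ℚₚ.p≤p⊔q (K Fin.zero) M
  (Fin.suc r) → ℚₚ.≤-trans (K≤M r) (ℚₚ.p≤q⊔p (K Fin.zero) M)

-- With M the maximum of the finitely many constants of `lowerTerms-bound`, the error times G is at
-- most M G^D. So any N with M < ε N works.
hasLimitOverPower : ∀ H D {lc} → HasQuasiPolyLC H D lc → HasLimitOverPower H D lc
hasLimitOverPower H D {lc} (q , P , last-P , eval-P) ε 0<ε
  with upperBound (λ r → proj₁ (lowerTerms-bound (P r)))
... | M , K≤M with <-*ℕtoℚ M ε 0<ε
... | N , M<εN = N , close
  where
  open ℚₚ.≤-Reasoning
  close : ∀ G → N ℕ.≤ G → 1 ℕ.≤ G → ∣ ℕtoℚ (H G) - lc * (ℕtoℚ G ^ℚ D) ∣ ℚ.< ε * (ℕtoℚ G ^ℚ D)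
  close G N≤G 1≤G = ℚₚ.*-cancelʳ-<-nonNeg x (begin-strict
    ∣ ℕtoℚ (H G) - lc * p ∣ * x
      ≡⟨ cong₂ (λ u v → ∣ u - v * p ∣ * x) (eval-P G) (sym (last-P r)) ⟩
    ∣ evalPoly (P r) x - Vec.last (P r) * p ∣ * x
      ≤⟨ proj₂ (lowerTerms-bound (P r)) x 1≤x ⟩
    proj₁ (lowerTerms-bound (P r)) * p
      ≤⟨ ℚₚ.*-monoʳ-≤-nonNeg p (K≤M r) ⟩
    M * p
      <⟨ ℚₚ.*-monoˡ-<-pos p M<εN ⟩
    ε * ℕtoℚ N * p
      ≤⟨ ℚₚ.*-monoʳ-≤-nonNeg p (ℚₚ.*-monoˡ-≤-nonNeg ε (ℕtoℚ-mono-≤ N≤G)) ⟩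
    ε * x * p
      ≡⟨ solve 3 (λ ε x p → ε :* x :* p := ε :* p :* x) refl ε x p ⟩
    ε * p * x ∎)
    where
    r = G ℕ.mod suc q
    x = ℕtoℚ G
    p = x ^ℚ D
    1≤x : 1ℚ ℚ.≤ x
    1≤x = ℕtoℚ-mono-≤ 1≤G
    instance
      x-nonNeg : NonNegative x
      x-nonNeg = ℚ.nonNegative (ℚₚ.≤-trans (ℚₚ.nonNegative⁻¹ 1ℚ) 1≤x)
      p-pos : Positive p
      p-pos = ℚ.positive (ℚₚ.<-≤-trans (ℚₚ.positive⁻¹ 1ℚ) (1≤^ℚ D 1≤x))
      p-nonNeg : NonNegative p
      p-nonNeg = ℚₚ.pos⇒nonNeg p
      ε-nonNeg : NonNegative ε
      ε-nonNeg = ℚ.nonNegative (ℚₚ.<⇒≤ 0<ε)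

-- Symmetric functions in monomials

sumTo : ℕ → Seq → ℚ
sumTo zero φ = 0ℚ
sumTo (suc n) φ = φ 0 + sumTo n (φ ∘ suc)

sumTo-cong : ∀ {φ ψ} n → φ ≋ ψ → sumTo n φ ≡ sumTo n ψ
sumTo-cong zero eq = refl
sumTo-cong (suc n) eq = cong₂ _+_ (eq 0) (sumTo-cong n (eq ∘ suc))

sumTo-snoc : ∀ n φ → sumTo (suc n) φ ≡ sumTo n φ + φ n
sumTo-snoc zero φ = ℚₚ.+-comm (φ 0) 0ℚ
sumTo-snoc (suc n) φ =
  trans (cong (φ 0 +_) (sumTo-snoc n (φ ∘ suc))) (sym (ℚₚ.+-assoc (φ 0) _ _))

sumTo-0 : ∀ n → sumTo n (λ _ → 0ℚ) ≡ 0ℚ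
sumTo-0 zero = refl
sumTo-0 (suc n) = trans (ℚₚ.+-identityˡ _) (sumTo-0 n)

-- Both sides sum over a < min(m, n). Counting lets a range up to the total and tests it against the
-- previous row sum; `complete-unfold` does the reverse.
sumTo-swap-bounds : ∀ m n (φ : Seq) → sumTo m (λ a → if a <ᵇ n then φ a else 0ℚ) ≡
                              sumTo n (λ a → if a <ᵇ m then φ a else 0ℚ)
sumTo-swap-bounds zero n φ = sym (sumTo-0 n)
sumTo-swap-bounds (suc m) zero φ = sumTo-0 (suc m)
sumTo-swap-bounds (suc m) (suc n) φ = cong (φ 0 +_) (sumTo-swap-bounds m n (φ ∘ suc))

sumTo-truncate : ∀ {m n} (φ : Seq) → m ℕ.≤ n → sumTo n (λ a → if a <ᵇ m then φ a else 0ℚ) ≡ sumTo m φ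
sumTo-truncate {n = n} φ z≤n = sumTo-0 n
sumTo-truncate φ (s≤s m≤n) = cong (φ 0 +_) (sumTo-truncate (φ ∘ suc) m≤n)

⊛-sumTo : ∀ f g n → (f ⊛ g) n ≡ sumTo (suc n) (λ a → f a * g (n ∸ a))
⊛-sumTo f g zero = sym (ℚₚ.+-identityʳ (f 0 * g 0))
⊛-sumTo f g (suc n) = cong (f 0 * g (suc n) +_) (⊛-sumTo (f ∘ suc) g n)

monomial : ℚ → ℕ → Seq
monomial c zero zero = c
monomial c zero (suc n) = 0ℚ
monomial c (suc a) zero = 0ℚ
monomial c (suc a) (suc n) = monomial c a n

monomial-⊛ : ∀ c a f n → (monomial c a ⊛ f) n ≡ (if a <ᵇ suc n then c * f (n ∸ a) else 0ℚ)
monomial-⊛ c zero f zero = refl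
monomial-⊛ c zero f (suc n) =
  trans (cong (c * f (suc n) +_) (⊛-zeroˡ f n)) (ℚₚ.+-identityʳ (c * f (suc n)))
monomial-⊛ c (suc a) f zero = ℚₚ.*-zeroˡ (f 0)
monomial-⊛ c (suc a) f (suc n) =
  trans (cong₂ _+_ (ℚₚ.*-zeroˡ (f (suc n))) (monomial-⊛ c a f n)) (ℚₚ.+-identityˡ _)

monomial-diagonal : ∀ c a → monomial c a a ≡ c
monomial-diagonal c zero = refl
monomial-diagonal c (suc a) = monomial-diagonal c a

monomial-≢ : ∀ c {a n} → n ≢ a → monomial c a n ≡ 0ℚ
monomial-≢ c {zero} {zero} n≢a with () ← n≢a refl
monomial-≢ c {zero} {suc n} n≢a = refl
monomial-≢ c {suc a} {zero} n≢a = refl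
monomial-≢ c {suc a} {suc n} n≢a = monomial-≢ c (n≢a ∘ cong suc)

monomial-product : ∀ c d a b → monomial c a ⊛ monomial d b ≋ monomial (c * d) (a ℕ.+ b)
monomial-product c d (suc a) b zero = ℚₚ.*-zeroˡ (monomial d b 0)
monomial-product c d (suc a) b (suc n) =
  trans (cong₂ _+_ (ℚₚ.*-zeroˡ (monomial d b (suc n))) (monomial-product c d a b n)) (ℚₚ.+-identityˡ _)
monomial-product c d zero b n = trans (monomial-⊛ c 0 (monomial d b) n) (scale b n)
  where
  scale : ∀ b n → c * monomial d b n ≡ monomial (c * d) b n
  scale zero zero = refl
  scale zero (suc n) = ℚₚ.*-zeroʳ c
  scale (suc b) zero = ℚₚ.*-zeroʳ c
  scale (suc b) (suc n) = scale b n

monomial-^ : ∀ c a i → monomial c a ^ i ≋ monomial (c ^ℚ i) (i ℕ.* a)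
monomial-^ c a zero zero = refl
monomial-^ c a zero (suc n) = refl
monomial-^ c a (suc i) n =
  trans (⊛-cong {f = monomial c a} (λ _ → refl) (monomial-^ c a i) n)
        (monomial-product c (c ^ℚ i) a (i ℕ.* a) n)

·-ℕtoℚ : ∀ m f n → (m · f) n ≡ ℕtoℚ m * f n
·-ℕtoℚ zero f n = sym (ℚₚ.*-zeroˡ (f n))
·-ℕtoℚ (suc m) f n = begin
  f n + (m · f) n             ≡⟨ cong (f n +_) (·-ℕtoℚ m f n) ⟩
  f n + ℕtoℚ m * f n          ≡⟨ solve 2 (λ m x → x :+ m :* x := (con 1ℚ :+ m) :* x) refl (ℕtoℚ m) (f n) ⟩
  (1ℚ + ℕtoℚ m) * f n         ≡⟨ cong (_* f n) (ℕtoℚ-+ 1 m) ⟨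
  ℕtoℚ (suc m) * f n          ∎
  where open ≡-Reasoning

module Graded (v : Seq) where

  y : ℕ → Seq
  y a = monomial (v a) a

  -- Monomials are sorted by their largest index a; the other factors then lie among y₀, ..., y_a.
  -- The test drops a > n, where y_a = v a xᵃ cannot reach xⁿ.
  complete-unfold : ∀ N m n → complete y N (suc m) n ≡
    sumTo N (λ a → if a <ᵇ suc n then v a * complete y (suc a) m (n ∸ a) else 0ℚ)
  complete-unfold zero m n = refl
  complete-unfold (suc N) m n = trans
    (cong₂ _+_ (complete-unfold N m n) (monomial-⊛ (v N) N (complete y (suc N) m) n))
    (sym (sumTo-snoc N _))

  -- The complete homogeneous symmetric functions of all the variables y₀, y₁, …: the coefficient
  -- of xⁿ only involves y₀, …, yₙ.
  completeLimit : ℕ → Seq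
  completeLimit m n = complete y (suc n) m n

  complete-stable : ∀ m {N n} → n ℕ.< N → complete y N m n ≡ completeLimit m n
  complete-stable zero n<N = refl
  complete-stable (suc m) {N} {n} n<N = begin
    complete y N (suc m) n
      ≡⟨ complete-unfold N m n ⟩
    sumTo N (λ a → if a <ᵇ suc n then v a * complete y (suc a) m (n ∸ a) else 0ℚ)
      ≡⟨ sumTo-truncate (λ a → v a * complete y (suc a) m (n ∸ a)) n<N ⟩
    sumTo (suc n) (λ a → v a * complete y (suc a) m (n ∸ a))
      ≡⟨ sumTo-truncate (λ a → v a * complete y (suc a) m (n ∸ a)) (ℕₚ.≤-refl {suc n}) ⟨
    sumTo (suc n) (λ a → if a <ᵇ suc n then v a * complete y (suc a) m (n ∸ a) else 0ℚ)
      ≡⟨ complete-unfold (suc n) m n ⟨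
    completeLimit (suc m) n ∎
    where open ≡-Reasoning

  -- This is pᵢ₊₁ in all the variables, since the power i + 1 of y_a is the monomial with
  -- coefficient (v a)ⁱ⁺¹ at x^((i + 1) a).
  powerLimit : ℕ → Seq
  powerLimit i = expand (suc i) (λ a → v a ^ℚ suc i)

  powerSum-nonmultiple : ∀ N i {n} → n ℕ.% suc i ≢ 0 → powerSum y N i n ≡ 0ℚ
  powerSum-nonmultiple zero i n%≢0 = refl
  powerSum-nonmultiple (suc N) i {n} n%≢0 = cong₂ _+_ (powerSum-nonmultiple N i n%≢0)
    (trans (monomial-^ (v N) N (suc i) n) (monomial-≢ (v N ^ℚ suc i) {suc i ℕ.* N} λ where
      refl → n%≢0 (trans (ℕ.%-congˡ {o = suc i} (ℕₚ.*-comm (suc i) N)) (ℕ.m*n%n≡0 N (suc i)))))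

  powerSum-beyond : ∀ N i {b} → N ℕ.≤ b → powerSum y N i (b ℕ.* suc i) ≡ 0ℚ
  powerSum-beyond zero i N≤b = refl
  powerSum-beyond (suc N) i {b} N<b = cong₂ _+_ (powerSum-beyond N i (ℕₚ.<⇒≤ N<b))
    (trans (monomial-^ (v N) N (suc i) (b ℕ.* suc i)) (monomial-≢ (v N ^ℚ suc i)
      (λ eq → ℕₚ.<⇒≢ N<b (sym (ℕₚ.*-cancelʳ-≡ b N (suc i) (trans eq (ℕₚ.*-comm (suc i) N)))))))

  powerSum-multiple : ∀ N i {b} → b ℕ.< N → powerSum y N i (b ℕ.* suc i) ≡ v b ^ℚ suc i
  powerSum-multiple (suc N) i {b} b<sN with ℕₚ.m<1+n⇒m<n∨m≡n b<sN
  ... | inj₁ b<N = trans (cong₂ _+_ (powerSum-multiple N i b<N)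
    (trans (monomial-^ (v N) N (suc i) (b ℕ.* suc i)) (monomial-≢ (v N ^ℚ suc i)
      (λ eq → ℕₚ.<⇒≢ b<N (ℕₚ.*-cancelʳ-≡ b N (suc i) (trans eq (ℕₚ.*-comm (suc i) N)))))))
    (ℚₚ.+-identityʳ _)
  ... | inj₂ refl = trans (cong₂ _+_ (powerSum-beyond N i ℕₚ.≤-refl)
    (trans (monomial-^ (v N) N (suc i) (N ℕ.* suc i))
      (trans (cong (monomial (v N ^ℚ suc i) (suc i ℕ.* N)) (ℕₚ.*-comm N (suc i)))
             (monomial-diagonal (v N ^ℚ suc i) (suc i ℕ.* N)))))
    (ℚₚ.+-identityˡ _)

  powerSum-stable : ∀ i {N n} → n ℕ.< N → powerSum y N i n ≡ powerLimit i n
  powerSum-stable i {N} {n} n<N with n ℕ.% suc i in eq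
  ... | suc r = powerSum-nonmultiple N i (λ eq′ → ℕₚ.1+n≢0 (trans (sym eq) eq′))
  ... | zero = trans (cong (powerSum y N i) n≡)
    (powerSum-multiple N i (ℕₚ.≤-<-trans (ℕ.m/n≤m n (suc i)) n<N))
    where
    n≡ : n ≡ n ℕ./ suc i ℕ.* suc i
    n≡ = trans (ℕ.m≡m%n+[m/n]*n n (suc i)) (cong (ℕ._+ n ℕ./ suc i ℕ.* suc i) eq)

  open Series seriesRing using () renaming (_⊛_ to _⊛ₛ_)

  ⊛ₛ-cong-≤ : ∀ m {p p′ h h′ : ℕ → Seq} n → (∀ i j → j ℕ.≤ n → p i j ≡ p′ i j) →
              (∀ i j → j ℕ.≤ n → h i j ≡ h′ i j) → (p ⊛ₛ h) m n ≡ (p′ ⊛ₛ h′) m n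
  ⊛ₛ-cong-≤ zero n P Q = ⊛-cong-≤ n (P 0) (Q 0)
  ⊛ₛ-cong-≤ (suc m) n P Q = cong₂ _+_ (⊛-cong-≤ n (P 0) (Q (suc m))) (⊛ₛ-cong-≤ m n (P ∘ suc) Q)

  -- For fixed n the variables y₀, ..., yₙ suffice: up to xⁿ, all coefficients involved are already
  -- stable.
  newtonLimit : ∀ m n → ℕtoℚ (suc m) * completeLimit (suc m) n ≡ (powerLimit ⊛ₛ completeLimit) m n
  newtonLimit m n = begin
    ℕtoℚ (suc m) * completeLimit (suc m) n
      ≡⟨ ·-ℕtoℚ (suc m) (complete y (suc n) (suc m)) n ⟨
    (suc m · complete y (suc n) (suc m)) n
      ≡⟨ newton y (suc n) m n ⟩
    (powerSum y (suc n) ⊛ₛ complete y (suc n)) m n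
      ≡⟨ ⊛ₛ-cong-≤ m n (λ i j j≤n → powerSum-stable i (s≤s j≤n))
                       (λ i j j≤n → complete-stable i (s≤s j≤n)) ⟩
    (powerLimit ⊛ₛ completeLimit) m n ∎
    where open ≡-Reasoning

-- Counting ordered score sheets

module _ {A : Set} where

  count : (A → Bool) → List A → ℕ
  count p xs = length (filterᵇ p xs)

  count-++ : ∀ p xs ys → count p (xs ++ ys) ≡ count p xs ℕ.+ count p ys
  count-++ p [] ys = refl
  count-++ p (x ∷ xs) ys with p x
  ... | true = cong suc (count-++ p xs ys)
  ... | false = count-++ p xs ys

  count-cong : ∀ {p q : A → Bool} → p ≗ q → ∀ xs → count p xs ≡ count q xs
  count-cong p≗q [] = refl
  count-cong {p} {q} p≗q (x ∷ xs) with p x | q x | p≗q x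
  ... | true  | .true  | refl = cong suc (count-cong p≗q xs)
  ... | false | .false | refl = count-cong p≗q xs

  count-∧ : ∀ b p xs → count (λ x → b ∧ p x) xs ≡ (if b then count p xs else 0)
  count-∧ true p xs = refl
  count-∧ false p [] = refl
  count-∧ false p (x ∷ xs) = count-∧ false p xs

  -- An abstract additive μ covers both `length`, for single rows, and `count p`, for sheets.
  concatMap-sumTo : ∀ (μ : List A → ℕ) → μ [] ≡ 0 → (∀ xs ys → μ (xs ++ ys) ≡ μ xs ℕ.+ μ ys) →
    ∀ {B : Set} (f : B → List A) g n →
    ℕtoℚ (μ (concatMap f (applyUpTo g n))) ≡ sumTo n (λ a → ℕtoℚ (μ (f (g a))))
  concatMap-sumTo μ μ-[] μ-++ f g zero = cong ℕtoℚ μ-[]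
  concatMap-sumTo μ μ-[] μ-++ f g (suc n) = begin
    ℕtoℚ (μ (f (g 0) ++ concatMap f (applyUpTo (g ∘ suc) n)))
      ≡⟨ cong ℕtoℚ (μ-++ (f (g 0)) _) ⟩
    ℕtoℚ (μ (f (g 0)) ℕ.+ μ (concatMap f (applyUpTo (g ∘ suc) n)))
      ≡⟨ ℕtoℚ-+ (μ (f (g 0))) _ ⟩
    ℕtoℚ (μ (f (g 0))) + ℕtoℚ (μ (concatMap f (applyUpTo (g ∘ suc) n)))
      ≡⟨ cong (ℕtoℚ (μ (f (g 0))) +_) (concatMap-sumTo μ μ-[] μ-++ f (g ∘ suc) n) ⟩
    sumTo (suc n) (λ a → ℕtoℚ (μ (f (g a)))) ∎
    where open ≡-Reasoning

count-map : ∀ {A B : Set} (p : B → Bool) (f : A → B) xs → count p (List.map f xs) ≡ count (p ∘ f) xs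
count-map p f [] = refl
count-map p f (x ∷ xs) with p (f x)
... | true = cong suc (count-map p f xs)
... | false = count-map p f xs

length-vecsSum : ∀ k G → ℕtoℚ (length (vecsSum k G)) ≡ B k G
length-vecsSum zero zero = refl
length-vecsSum zero (suc G) = refl
length-vecsSum (suc k) G = begin
  ℕtoℚ (length (vecsSum (suc k) G))
    ≡⟨ concatMap-sumTo length refl (λ xs _ → Listₚ.length-++ xs)
         (λ a → List.map (a ∷_) (vecsSum k (G ∸ a))) id (suc G) ⟩
  sumTo (suc G) (λ a → ℕtoℚ (length (List.map (a Vec.∷_) (vecsSum k (G ∸ a)))))
    ≡⟨ sumTo-cong (suc G) (λ a → trans (cong ℕtoℚ (Listₚ.length-map (a ∷_) (vecsSum k (G ∸ a))))
         (trans (length-vecsSum k (G ∸ a)) (sym (ℚₚ.*-identityˡ (B k (G ∸ a)))))) ⟩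
  sumTo (suc G) (λ a → 1ℚ * B k (G ∸ a))
    ≡⟨ ⊛-sumTo (λ _ → 1ℚ) (B k) G ⟨
  B (suc k) G ∎
  where open ≡-Reasoning

sum-vecsSum : ∀ k G → All (λ v → Vec.sum v ≡ G) (vecsSum k G)
sum-vecsSum zero zero = refl ∷ []
sum-vecsSum zero (suc G) = []
sum-vecsSum (suc k) G = Allₚ.concat⁺ (Allₚ.map⁺ (Allₚ.applyUpTo⁺₁ id (suc G) λ {a} a<1+G →
  Allₚ.map⁺ (All.map (λ eq → trans (cong (a ℕ.+_) eq) (ℕₚ.m+[n∸m]≡n (ℕₚ.≤-pred a<1+G)))
                     (sum-vecsSum k (G ∸ a)))))

count-rows : ∀ {k r a} (p : Vec (Vec ℕ k) (suc r) → Bool) (p′ : Vec (Vec ℕ k) r → Bool) Ms {rows} →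
  (∀ row S → Vec.sum row ≡ a → p (row ∷ S) ≡ p′ S) → All (λ v → Vec.sum v ≡ a) rows →
  count p (concatMap (λ row → List.map (row ∷_) Ms) rows) ≡ length rows ℕ.* count p′ Ms
count-rows p p′ Ms eq [] = refl
count-rows p p′ Ms {row ∷ rows} eq (sum-row ∷ sums) = begin
  count p (List.map (row ∷_) Ms ++ concatMap (λ row → List.map (row ∷_) Ms) rows)
    ≡⟨ count-++ p (List.map (row ∷_) Ms) _ ⟩
  count p (List.map (row ∷_) Ms) ℕ.+ count p (concatMap (λ row → List.map (row ∷_) Ms) rows)
    ≡⟨ cong₂ ℕ._+_ (trans (count-map p (row ∷_) Ms) (count-cong (λ S → eq row S sum-row) Ms))
                   (count-rows p p′ Ms eq sums) ⟩
  count p′ Ms ℕ.+ length rows ℕ.* count p′ Ms ∎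
  where open ≡-Reasoning

-- The predicate sees the first row only through its sum a, so the `B k a` rows of that sum
-- contribute equally.
count-matsSum : ∀ r k G (p : Vec (Vec ℕ k) (suc r) → Bool) (p′ : ℕ → Vec (Vec ℕ k) r → Bool) →
  (∀ row S → p (row ∷ S) ≡ p′ (Vec.sum row) S) →
  ℕtoℚ (count p (matsSum (suc r) k G)) ≡
  sumTo (suc G) (λ a → B k a * ℕtoℚ (count (p′ a) (matsSum r k (G ∸ a))))
count-matsSum r k G p p′ eq = trans
  (concatMap-sumTo (count p) refl (count-++ p)
    (λ a → concatMap (λ row → List.map (row ∷_) (matsSum r k (G ∸ a))) (vecsSum k a)) id (suc G))
  (sumTo-cong (suc G) λ a → trans
    (cong ℕtoℚ (count-rows p (p′ a) (matsSum r k (G ∸ a))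
      (λ row S sum-row → trans (eq row S) (cong (λ b → p′ b S) sum-row)) (sum-vecsSum k a)))
    (trans (ℕtoℚ-* (length (vecsSum k a)) _)
           (cong (_* ℕtoℚ (count (p′ a) (matsSum r k (G ∸ a)))) (length-vecsSum k a))))

-- The previous row sum b is all that the remaining rows need to know about the earlier ones;
-- putting it in front makes the ordering condition recursive.
boundedᵇ : ∀ {k r} → ℕ → Vec (Vec ℕ k) r → Bool
boundedᵇ b S = decreasingᵇ (b ∷ Vec.map Vec.sum S)

module Counting (k : ℕ) where
  open Graded (B k)

  -- Row sums b ≥ a₁ ≥ ... ≥ a_r correspond to monomials of degree r in y₀, ..., y_b; the first sum
  -- a₁ is the largest index singled out by `complete-unfold`.
  count-bounded : ∀ r b G → ℕtoℚ (count (boundedᵇ b) (matsSum r k G)) ≡ complete y (suc b) r G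
  count-bounded zero b zero = refl
  count-bounded zero b (suc G) = refl
  count-bounded (suc r) b G = begin
    ℕtoℚ (count (boundedᵇ b) (matsSum (suc r) k G))
      ≡⟨ count-matsSum r k G (boundedᵇ b) (λ a S → (a ≤ᵇ b) ∧ boundedᵇ a S) (λ _ _ → refl) ⟩
    sumTo (suc G) (λ a → B k a * ℕtoℚ (count (λ S → (a ≤ᵇ b) ∧ boundedᵇ a S) (matsSum r k (G ∸ a))))
      ≡⟨ sumTo-cong (suc G) bounded-term ⟩
    sumTo (suc G) (λ a → if a <ᵇ suc b then B k a * complete y (suc a) r (G ∸ a) else 0ℚ)
      ≡⟨ sumTo-swap-bounds (suc G) (suc b) (λ a → B k a * complete y (suc a) r (G ∸ a)) ⟩
    sumTo (suc b) (λ a → if a <ᵇ suc G then B k a * complete y (suc a) r (G ∸ a) else 0ℚ)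
      ≡⟨ complete-unfold (suc b) r G ⟨
    complete y (suc b) (suc r) G ∎
    where
    open ≡-Reasoning
    ≤ᵇ-<ᵇ : ∀ a → (a ≤ᵇ b) ≡ (a <ᵇ suc b)
    ≤ᵇ-<ᵇ zero = refl
    ≤ᵇ-<ᵇ (suc a) = refl
    bounded-term : ∀ a → B k a * ℕtoℚ (count (λ S → (a ≤ᵇ b) ∧ boundedᵇ a S) (matsSum r k (G ∸ a))) ≡
                         (if a <ᵇ suc b then B k a * complete y (suc a) r (G ∸ a) else 0ℚ)
    bounded-term a rewrite count-∧ (a ≤ᵇ b) (boundedᵇ a) (matsSum r k (G ∸ a)) | ≤ᵇ-<ᵇ a
      with a <ᵇ suc b
    ... | true = cong (B k a *_) (count-bounded r a (G ∸ a))
    ... | false = ℚₚ.*-zeroʳ (B k a)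

hilbert-complete : ∀ r G → ℕtoℚ (hilbert (suc r) G) ≡ Graded.completeLimit (B r) (suc r) G
hilbert-complete r G = begin
  ℕtoℚ (hilbert (suc r) G)
    ≡⟨ count-matsSum r r G isOrderedᵇ boundedᵇ (λ _ _ → refl) ⟩
  sumTo (suc G) (λ a → B r a * ℕtoℚ (count (boundedᵇ a) (matsSum r r (G ∸ a))))
    ≡⟨ sumTo-cong (suc G) (λ a → cong (B r a *_) (count-bounded r a (G ∸ a))) ⟩
  sumTo (suc G) (λ a → B r a * complete y (suc a) r (G ∸ a))
    ≡⟨ sumTo-truncate (λ a → B r a * complete y (suc a) r (G ∸ a)) (ℕₚ.≤-refl {suc G}) ⟨
  sumTo (suc G) (λ a → if a <ᵇ suc G then B r a * complete y (suc a) r (G ∸ a) else 0ℚ)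
    ≡⟨ complete-unfold (suc G) r G ⟨
  completeLimit (suc r) G ∎
  where
  open ≡-Reasoning
  open Graded (B r)
  open Counting r

-- The leading term

-- Here κ = k - 1 is the degree of `B k`, and q is a common period for p₁, ..., pₙ.
module Leading (κ q n : ℕ) (divides : ∀ i → suc i ℕ.≤ n → suc i ℕ.∣ q) where

  k : ℕ
  k = suc κ

  open Graded (B k)
  open Series seriesRing using () renaming (_⊛_ to _⊛ₛ_)

  quasiPoly-power : ∀ c i → QuasiPoly c (suc (i ℕ.* κ)) (λ a → B k a ^ℚ i)
  quasiPoly-power c zero = quasiPoly-1 c
  quasiPoly-power c (suc i) = quasiPoly-product κ (i ℕ.* κ) (quasiPoly-B c κ) (quasiPoly-power c i)

  quasiPoly-powerLimit : ∀ i → suc i ℕ.≤ n → QuasiPoly q (suc (suc i ℕ.* κ)) (powerLimit i)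
  quasiPoly-powerLimit i i<n with divides i i<n
  ... | ℕ.divides c refl = quasiPoly-expand (suc i) (quasiPoly-power c (suc i))

  powerLimit-0 : powerLimit 0 ≋ B k
  powerLimit-0 a rewrite ℕ.n%1≡0 a | ℕ.n/1≡n a = ℚₚ.*-identityʳ (B k a)

  remainder : ℕ → Seq
  remainder m G = completeLimit m G - invFact m * B (m ℕ.* k) G

  -- B (m k) has degree m k − 1, and the remainder degree at most m k − 2.
  HasLeadingTerm : ℕ → Set
  HasLeadingTerm m = QuasiPoly q (m ℕ.* k ∸ 1) (remainder m)

  complete-remainder : ∀ m G → completeLimit m G ≡ remainder m G + invFact m * B (m ℕ.* k) G
  complete-remainder m G = solve 2 (λ x y → x := x :- y :+ y) refl
    (completeLimit m G) (invFact m * B (m ℕ.* k) G)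

  -- The index is positive because h₀ = `δ` is nonzero, whereas order 0 forces the zero sequence.
  quasiPoly-complete : ∀ m → HasLeadingTerm (suc m) → QuasiPoly q (suc m ℕ.* k) (completeLimit (suc m))
  quasiPoly-complete m leading = quasiPoly-cong (λ G → sym (complete-remainder (suc m) G))
    (quasiPoly-+ (quasiPoly-≤ (ℕₚ.n≤1+n _) leading)
                 (quasiPoly-scale (invFact (suc m)) (quasiPoly-B q (κ ℕ.+ m ℕ.* k))))

  -- With i = b + 1, the right side is i κ + (i - 1). This is the point where i ≥ 2 is decisive: pᵢ
  -- loses at least one order against p₁ⁱ.
  power-degree : ∀ b → 1 ℕ.≤ b → suc (suc b ℕ.* κ) ℕ.≤ suc b ℕ.* k ∸ 1
  power-degree b 1≤b = subst (λ x → suc (suc b ℕ.* κ) ℕ.≤ x ∸ 1) (sym (ℕₚ.*-suc (suc b) κ))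
    (ℕₚ.+-monoˡ-≤ (suc b ℕ.* κ) 1≤b)

  -- The power sums p₂, p₃, … only contribute in lower degree.
  quasiPoly-higher : ∀ m a (p : ℕ → Seq) → 1 ℕ.≤ a →
    (∀ i → i ℕ.≤ m → QuasiPoly q (suc (suc (a ℕ.+ i) ℕ.* κ)) (p i)) →
    (∀ j → suc j ℕ.≤ m → HasLeadingTerm (suc j)) →
    QuasiPoly q (suc (a ℕ.+ m) ℕ.* k ∸ 1) ((p ⊛ₛ completeLimit) m)
  -- The offset a records the shifts made by the recursion of `_⊛ₛ_`: `p i` stands for the power sum
  -- of index a + i + 1. At m = 0 the factor h₀ = `δ` disappears.
  quasiPoly-higher zero a p 1≤a P L =
    quasiPoly-cong (λ G → sym (trans (⊛-comm (p 0) δ G) (⊛-identityˡ (p 0) G)))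
      (quasiPoly-≤ (power-degree (a ℕ.+ 0) (ℕₚ.m≤n⇒m≤n+o 0 1≤a)) (P 0 z≤n))
  quasiPoly-higher (suc m) a p 1≤a P L = quasiPoly-+
    (quasiPoly-≤ degree (quasiPoly-⊛ (P 0 z≤n) (quasiPoly-complete m (L m ℕₚ.≤-refl))))
    (subst (λ b → QuasiPoly q (suc b ℕ.* k ∸ 1) (((p ∘ suc) ⊛ₛ completeLimit) m)) (sym (ℕₚ.+-suc a m))
      (quasiPoly-higher m (suc a) (p ∘ suc) (s≤s z≤n)
        (λ i i≤m → subst (λ b → QuasiPoly q (suc (suc b ℕ.* κ)) (p (suc i))) (ℕₚ.+-suc a i)
                     (P (suc i) (s≤s i≤m)))
        (λ j j<m → L j (ℕₚ.m≤n⇒m≤1+n j<m))))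
    where
    degree : suc (suc (a ℕ.+ 0) ℕ.* κ) ℕ.+ suc m ℕ.* k ℕ.≤ suc (a ℕ.+ suc m) ℕ.* k ∸ 1
    degree = ℕₚ.≤-trans
      (ℕₚ.+-monoˡ-≤ (suc m ℕ.* k) (power-degree (a ℕ.+ 0) (ℕₚ.m≤n⇒m≤n+o 0 1≤a)))
      (ℕₚ.≤-reflexive (cong (_∸ 1) (trans (sym (ℕₚ.*-distribʳ-+ k (suc (a ℕ.+ 0)) (suc m)))
        (cong (λ b → (suc b ℕ.+ suc m) ℕ.* k) (ℕₚ.+-identityʳ a)))))

  -- Newton's sum for (m + 1) hₘ₊₁ without p₁ hₘ; for m = 0 nothing else is left.
  higher : ℕ → Seq
  higher zero G = 0ℚ
  higher (suc m) = ((powerLimit ∘ suc) ⊛ₛ completeLimit) m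

  newton-split : ∀ m → (powerLimit ⊛ₛ completeLimit) m ≋ λ G → (B k ⊛ completeLimit m) G + higher m G
  newton-split zero G = trans (⊛-cong {g = δ} powerLimit-0 (λ _ → refl) G) (sym (ℚₚ.+-identityʳ _))
  newton-split (suc m) G =
    cong (_+ higher (suc m) G) (⊛-cong {g = completeLimit (suc m)} powerLimit-0 (λ _ → refl) G)

  -- The leading terms cancel exactly, because `B k ⊛ B (m * k)` is `B (suc m * k)` and
  -- `invFact (suc m)` is `recip m * invFact m`.
  remainder-suc : ∀ m → remainder (suc m) ≋ λ G → recip m * ((B k ⊛ remainder m) G + higher m G)
  remainder-suc m G = begin
    F - recip m * invFact m * b
      ≡⟨ cong (_- recip m * invFact m * b) (sym (ℚₚ.*-identityˡ F)) ⟩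
    1ℚ * F - recip m * invFact m * b
      ≡⟨ cong (λ x → x * F - recip m * invFact m * b) (recip-inverse m) ⟨
    recip m * ℕtoℚ (suc m) * F - recip m * invFact m * b
      ≡⟨ solve 5 (λ ρ σ x i b → ρ :* σ :* x :- ρ :* i :* b := ρ :* (σ :* x :- i :* b)) refl
           (recip m) (ℕtoℚ (suc m)) F (invFact m) b ⟩
    recip m * (ℕtoℚ (suc m) * F - invFact m * b)
      ≡⟨ cong (λ x → recip m * (x - invFact m * b)) (trans (newtonLimit m G) (newton-split m G)) ⟩
    recip m * ((B k ⊛ completeLimit m) G + higher m G - invFact m * b)
      ≡⟨ cong (λ x → recip m * (x + higher m G - invFact m * b)) split ⟩
    recip m * ((B k ⊛ remainder m) G + invFact m * b + higher m G - invFact m * b)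
      ≡⟨ cong (recip m *_) (solve 3 (λ r x h → r :+ x :+ h :- x := r :+ h) refl
           ((B k ⊛ remainder m) G) (invFact m * b) (higher m G)) ⟩
    recip m * ((B k ⊛ remainder m) G + higher m G) ∎
    where
    open ≡-Reasoning
    F = completeLimit (suc m) G
    b = B (suc m ℕ.* k) G
    lead : Seq
    lead n = invFact m * B (m ℕ.* k) n
    split : (B k ⊛ completeLimit m) G ≡ (B k ⊛ remainder m) G + invFact m * b
    split = begin
      (B k ⊛ completeLimit m) G
        ≡⟨ ⊛-cong {B k} (λ _ → refl) (complete-remainder m) G ⟩
      (B k ⊛ (λ n → remainder m n + lead n)) G
        ≡⟨ ⊛-comm (B k) _ G ⟩
      ((λ n → remainder m n + lead n) ⊛ B k) G
        ≡⟨ ⊛-distribʳ (B k) (remainder m) lead G ⟩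
      (remainder m ⊛ B k) G + (lead ⊛ B k) G
        ≡⟨ cong₂ _+_ (⊛-comm (remainder m) (B k) G)
             (trans (⊛-scaleˡ (invFact m) (B (m ℕ.* k)) (B k) G)
               (cong (invFact m *_) (trans (⊛-comm (B (m ℕ.* k)) (B k) G) (B-+ k (m ℕ.* k) G)))) ⟩
      (B k ⊛ remainder m) G + invFact m * b ∎

  hasLeadingTerm-suc : ∀ m → suc m ℕ.≤ n → (∀ j → j ℕ.≤ m → HasLeadingTerm j) → HasLeadingTerm (suc m)
  hasLeadingTerm-suc m m<n L = quasiPoly-cong (λ G → sym (remainder-suc m G))
    (quasiPoly-scale (recip m) (quasiPoly-+ (first m (L m ℕₚ.≤-refl)) (rest m m<n L)))
    where
    first : ∀ m → HasLeadingTerm m → QuasiPoly q (suc m ℕ.* k ∸ 1) (B k ⊛ remainder m)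
    -- The general bound would give order k here, one too many; the vanishing of `remainder 0` saves
    -- it.
    first zero (zeroSeq p) = quasiPoly-0 (1 ℕ.* k ∸ 1) λ G →
      trans (⊛-comm (B k) (remainder 0) G)
        (trans (⊛-cong {g = B k} p (λ _ → refl) G) (⊛-zeroˡ (B k) G))
    first (suc m) L = quasiPoly-≤ (ℕₚ.≤-reflexive (sym (ℕₚ.+-suc κ (κ ℕ.+ m ℕ.* k))))
      (quasiPoly-B⊛ k L)
    rest : ∀ m → suc m ℕ.≤ n → (∀ j → j ℕ.≤ m → HasLeadingTerm j) →
           QuasiPoly q (suc m ℕ.* k ∸ 1) (higher m)
    rest zero _ _ = quasiPoly-0 (1 ℕ.* k ∸ 1) (λ _ → refl)
    rest (suc m) m<n L = quasiPoly-higher m 1 (powerLimit ∘ suc) ℕₚ.≤-refl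
      (λ i i≤m → quasiPoly-powerLimit (suc i) (ℕₚ.≤-trans (s≤s (s≤s i≤m)) m<n))
      (λ j j<m → L (suc j) (ℕₚ.m≤n⇒m≤1+n j<m))

  hasLeadingTerms : ∀ m → m ℕ.≤ n → ∀ j → j ℕ.≤ m → HasLeadingTerm j
  -- The truncated subtraction `0 * k ∸ 1` is 0, so the remainder has to vanish, and it does: h₀ and
  -- `B 0` are both `δ`.
  hasLeadingTerms m m≤n zero j≤m = zeroSeq λ G →
    solve 1 (λ x → x :- con 1ℚ :* x := con 0ℚ) refl (δ G)
  hasLeadingTerms (suc m) m<n (suc j) (s≤s j≤m) =
    hasLeadingTerm-suc j (ℕₚ.≤-trans (s≤s j≤m) m<n)
      (λ i i≤j → hasLeadingTerms m (ℕₚ.<⇒≤ m<n) i (ℕₚ.≤-trans i≤j j≤m))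

suc-∣-! : ∀ n i → suc i ℕ.≤ n → suc i ℕ.∣ n !
suc-∣-! n i i<n = ℕ.∣-trans (ℕ.m∣m*n (i !)) (ℕ.m≤n⇒m!∣n! i<n)

theorem5p1 : (n : ℕ) → 2 ≤ n →
    Σ ℚ λ lc →
    (lc Data.Rational.* ℕtoℚ ((n !) Data.Nat.* ((n Data.Nat.* n ∸ n ∸ 1) !)) ≡ 1ℚ) ×
    HasQuasiPolyLC (hilbert n) (n Data.Nat.* n ∸ n ∸ 1) lc ×
    HasLimitOverPower (hilbert n) (n Data.Nat.* n ∸ n ∸ 1) lc
theorem5p1 n@(suc (suc κ)) (s≤s (s≤s z≤n)) =
  invFact n * invFact D , normalised , quasi , hasLimitOverPower (hilbert n) D quasi
  where
  D q : ℕ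
  D = n ℕ.* n ∸ n ∸ 1
  q = ℕ.pred (n !)

  suc-q : n ! ≡ suc q
  suc-q = sym (ℕₚ.suc-pred (n !) {{n ℕₚ.!≢0}})

  -- Rows have k = n - 1 = κ + 1 entries, so n k counts all n² - n entries, and `B (n * k)` has
  -- degree n k - 1 = D.
  nk≡1+D : n ℕ.* suc κ ≡ suc D
  nk≡1+D = cong (λ x → suc (x ∸ 1))
    (sym (trans (cong (_∸ n) (ℕₚ.*-suc n (suc κ))) (ℕₚ.m+n∸m≡n n (n ℕ.* suc κ))))

  leading : QuasiPoly (suc q) D (λ G → ℕtoℚ (hilbert n G) - invFact n * B (suc D) G)
  leading = quasiPoly-cong
    (λ G → cong₂ (λ h s → h - invFact n * B s G) (sym (hilbert-complete (suc κ) G)) nk≡1+D)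
    (subst₂ (λ c s → QuasiPoly c s (remainder n)) suc-q (cong (_∸ 1) nk≡1+D)
      (hasLeadingTerms n ℕₚ.≤-refl n ℕₚ.≤-refl))
    where open Leading κ (n !) n (suc-∣-! n)

  quasi : HasQuasiPolyLC (hilbert n) D (invFact n * invFact D)
  quasi = hasQuasiPolyLC (hilbert n) D (invFact n) q leading

  normalised : invFact n * invFact D * ℕtoℚ (n ! ℕ.* D !) ≡ 1ℚ
  normalised = begin
    invFact n * invFact D * ℕtoℚ (n ! ℕ.* D !)
      ≡⟨ cong ((invFact n * invFact D) *_) (ℕtoℚ-* (n !) (D !)) ⟩
    invFact n * invFact D * (ℕtoℚ (n !) * ℕtoℚ (D !))
      ≡⟨ solve 4 (λ a b c d → a :* b :* (c :* d) := (a :* c) :* (b :* d)) refl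
           (invFact n) (invFact D) (ℕtoℚ (n !)) (ℕtoℚ (D !)) ⟩
    (invFact n * ℕtoℚ (n !)) * (invFact D * ℕtoℚ (D !))
      ≡⟨ cong₂ _*_ (invFact-inverse n) (invFact-inverse D) ⟩
    1ℚ ∎
    where open ≡-Reasoning
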